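{- Let $D,Q\in\mathbb N$ with $(D,Q)=1$ and $D/Q>1$, and suppose $D/Q$ is not the square of a rational number. Put $D_2=DQ$. Let $m\ge0$ be smallest possible such that $\sqrt{D/Q}=[b_0,\{b_1,\ldots,b_m,2b_0\}]$ with $b_0,\ldots,b_m\in\mathbb N$, and let $n\ge 0$ be smallest possible such that $\sqrt{D_2}=[b'_0,\{b'_1,\ldots,b'_n,2b'_0\}]$ with $b'_0,\ldots,b'_n\in\mathbb N$. Let $r_k/s_k$ be the $k$th convergent of $\sqrt{D/Q}$ and $r'_k/s'_k$ the $k$th convergent of $\sqrt{D_2}$. Then $$r_{l(m+1)-1}=r'_{l(n+1)-1},\qquad s_{l(m+1)-1}=s'_{l(n+1)-1}\,Q$$ for all $l\in\mathbb N$.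
   Context: $\mathbb N=\{1,2,3,\ldots\}$ and $(a,b)$ denotes the greatest common divisor. The notation $[b_0,\{b_1,\ldots,b_m,2b_0\}]$ denotes the infinite simple continued fraction with initial term $b_0$ followed by the block $b_1,\ldots,b_m,2b_0$ (of length $m+1$) repeated periodically forever; both $\sqrt{D/Q}$ and $\sqrt{D_2}$ have expansions of this form. Convergents $r_k/s_k=[b_0,b_1,\ldots,b_k]$ (and likewise $r'_k/s'_k=[b'_0,\ldots,b'_k]$) are indexed from $k=0$ and written in lowest terms with positive integer numerators and denominators. -}

module Defs where

open import Data.Integer.Base using (+_)
open import Data.Nat.Base as ℕ using (ℕ; zero; suc; NonZero)
open import Data.Nat.DivMod using (_mod_)
open import Data.Nat.Properties using (m*n≢0)
open import Data.Fin.Base using (Fin; zero; suc)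
open import Data.Product.Base using (_×_; ∃-syntax)
open import Data.Rational.Base
  using (ℚ; 0ℚ; _/_; _+_; _-_; _*_; 1/_; _<_; Positive)
open import Data.Rational.Properties
  using (normalize-pos; pos+pos⇒pos; 1/pos⇒pos; pos⇒nonZero)
open import Data.Sum.Base using (_⊎_)
open import Data.Vec.Base using (Vec; []; _∷_; _∷ʳ_; lookup)
open import Function.Base using (_∘_)

mutual

  -- [a 0 , a 1 , … , a k]
  cf : (a : ℕ → ℕ) → .(∀ i → NonZero (a i)) → ℕ → ℚ
  cf a a≢0 zero    = + a 0 / 1
  cf a a≢0 (suc k) = + a 0 / 1 + (1/ rest) {{pos⇒nonZero rest {{rest-pos}}}}
    where
    rest     = cf (a ∘ suc) (a≢0 ∘ suc) k
    rest-pos = cf-pos (a ∘ suc) (a≢0 ∘ suc) k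

  cf-pos : ∀ a .(a≢0 : ∀ i → NonZero (a i)) k → Positive (cf a a≢0 k)
  cf-pos a a≢0 zero    = normalize-pos (a 0) 1 {{_}} {{a≢0 0}}
  cf-pos a a≢0 (suc k) =
    pos+pos⇒pos (+ a 0 / 1) {{normalize-pos (a 0) 1 {{_}} {{a≢0 0}}}}
                ((1/ rest) {{pos⇒nonZero rest {{rest-pos}}}})
                {{1/pos⇒pos rest {{rest-pos}}}}
    where
    rest     = cf (a ∘ suc) (a≢0 ∘ suc) k
    rest-pos = cf-pos (a ∘ suc) (a≢0 ∘ suc) k

-- [b₀ , {b₁ , … , bₘ , 2b₀}] with bs = b₁ , … , bₘ
record PeriodicCF (m : ℕ) : Set where
  field
    b₀   : ℕ
    bs   : Vec ℕ m
    b₀≢0 : NonZero b₀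
    bs≢0 : ∀ i → NonZero (lookup bs i)

  term : ℕ → ℕ
  term zero    = b₀
  term (suc i) = lookup (bs ∷ʳ 2 ℕ.* b₀) (i mod suc m)

  term≢0 : ∀ i → NonZero (term i)
  term≢0 zero    = b₀≢0
  term≢0 (suc i) = go bs bs≢0 (i mod suc m)
    where
    go : ∀ {k} (v : Vec ℕ k) → (∀ j → NonZero (lookup v j)) →
         ∀ j → NonZero (lookup (v ∷ʳ 2 ℕ.* b₀) j)
    go []      v≢0 zero    = m*n≢0 2 b₀ {{_}} {{b₀≢0}}
    go (x ∷ v) v≢0 zero    = v≢0 zero
    go (x ∷ v) v≢0 (suc j) = go v (v≢0 ∘ suc) j

  -- Elements of ℚ are in lowest terms with positive denominator, so the
  -- numerator and denominator of the k-th convergent are ↥ and ↧ of this.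
  convergent : ℕ → ℚ
  convergent = cf term term≢0

open PeriodicCF public using (convergent)

-- For ρ > 0, the real number √ρ is given by its Dedekind cut in ℚ.

infix 4 _<√_ √_<_ √_≐_

_<√_ : ℚ → ℚ → Set
x <√ ρ = x < 0ℚ ⊎ x * x < ρ

√_<_ : ℚ → ℚ → Set
√ ρ < x = 0ℚ < x × ρ < x * x

-- √ρ is the value of the infinite continued fraction, i.e. the limit of its
-- convergents: |convergent b k - √ρ| < ε for all sufficiently large k.
√_≐_ : ∀ {m} → ℚ → PeriodicCF m → Set
√ ρ ≐ b = ∀ ε → 0ℚ < ε → ∃[ N ] ∀ k → N ℕ.≤ k →
          (convergent b k - ε <√ ρ) × (√ ρ < convergent b k + ε)

{-# OPTIONS --safe #-}

-- Let A be the matrix of one period of the expansion of √(D/Q), normalised so that it fixes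
-- √(D/Q). The forms Q x² − D y² and cross (v , A v) are both bounded along the orbit of
-- (1 , 0), whose denominators grow, so they are proportional and A = (x , D y ; Q y , x)
-- with x² − D Q y² = ±1. Conversely, the Euclidean algorithm factors the matrix of any
-- solution of this Pell equation into a period of an expansion of √(D/Q), so the shortest
-- period belongs to the smallest solution. The Pell equation of √(D Q) is the same one, and
-- the two period matrices are conjugate by (1 , 0 ; 0 , Q); their powers give the convergents.

module Submission where

open import Defs
open import Algebra.Properties.Group using (⁻¹-involutive)
open import Data.Fin.Base using (Fin; toℕ; inject₁) renaming (zero to fzero; suc to fsuc; fromℕ to maxFin)
import Data.Fin.Properties as Fin
open import Data.Integer.Base as ℤ using (ℤ; +_; 0ℤ; 1ℤ)
import Data.Integer.Properties as ℤ
import Data.Integer.Tactic.RingSolver as ℤ-ring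
open import Data.Nat.Base as ℕ using (ℕ; zero; suc; _*_; _∸_; _≤_; NonZero)
open import Data.Nat.Coprimality as Coprimality using (Coprime)
open import Data.Nat.DivMod as ℕ
  using (_mod_; _%_; m%n<n; [m+n]%n≡m%n; m<n⇒m%n≡m; m≡m%n+[m/n]*n; m≥n⇒m/n>0)
open import Data.Nat.Divisibility using (_∣_; divides; ∣m+n∣m⇒∣n; ∣n⇒∣m*n)
open import Data.Nat.GCD using (gcd)
import Data.Nat.Properties as ℕ
import Data.Nat.Tactic.RingSolver as ℕ-ring
open import Data.Product.Base using (_×_; _,_; proj₁; proj₂; ∃-syntax)
open import Data.Rational.Base as ℚ
  using (ℚ; mkℚ; 0ℚ; 1ℚ; _/_; ↥_; ↧ₙ_; *<*; *≤*; Positive)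
import Data.Rational.Properties as ℚ
import Data.Rational.Unnormalised.Base as ℚᵘ
import Data.Rational.Unnormalised.Properties as ℚᵘ
open import Data.Sum.Base using (_⊎_; inj₁; inj₂)
open import Data.Vec.Base using (Vec; []; _∷_; _∷ʳ_; lookup)
open import Function.Base using (_∘_)
open import Relation.Binary.PropositionalEquality
  using (_≡_; refl; sym; trans; cong; cong₂; subst; subst₂; module ≡-Reasoning)
open import Relation.Nullary.Negation using (¬_; contradiction)

-- Sequences of rationals alternating about a square root

-- Being an expansion of √(D/Q) is reduced to a sign condition: Q x² - D y² alternates in sign along
-- the columns (1 , 0), (r₀ , s₀), (r₁ , s₁), ..., and this alternation determines every term. The
-- reduction matters because minimality of `m` speaks only of expansions converging to √(D/Q), so a
-- Pell solution has to be turned into such an expansion before it can be compared with `b`. A Pell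
-- matrix multiplies the form by its determinant; hence in a continued fraction built from a
-- solution the signs, corrected by (-1)ⁿ, repeat with the period, and the first two decide them
-- all. It follows that its terms are those of `b`, and convergence is inherited from `b` without
-- estimates. Shortest means smallest because the entries of the columns increase.
--
-- The proportionality of the two bounded forms is a matter of integrality: a combination of them
-- without x² term is y times an integer, and once y exceeds the bound this integer is 0.

alt : {A : Set} → (A → A → Set) → ℕ → A → A → Set
alt R zero    x y = R x y
alt R (suc k) x y = alt R k y x

alt-map : ∀ {A B : Set} {R : A → A → Set} {S : B → B → Set} {x y x′ y′} →
          (R x y → S x′ y′) → (R y x → S y′ x′) →
          ∀ k → alt R k x y → alt S k x′ y′
alt-map f g zero    = f
alt-map f g (suc k) = alt-map g f k

alt-trans : ∀ {A : Set} {R : A → A → Set} → (∀ {x y z} → R x y → R y z → R x z) →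
            ∀ k {x y z} → alt R k x y → alt R k y z → alt R k x z
alt-trans t zero    p q = t p q
alt-trans t (suc k) p q = alt-trans t k q p

-- The quantifiers over `A`, `R`, `x` and `y` stand inside each case, so that a single split on the
-- parity serves several comparisons at once.
alt-parity : ∀ k →
  (∀ {A : Set} {R : A → A → Set} {x y} → (alt R k x y → R x y) × (R x y → alt R k x y)) ⊎
  (∀ {A : Set} {R : A → A → Set} {x y} → (alt R k x y → R y x) × (R y x → alt R k x y))
alt-parity zero = inj₁ ((λ p → p) , λ p → p)
alt-parity (suc k) with alt-parity k
... | inj₁ e = inj₂ e
... | inj₂ o = inj₁ o

-- Order of finite continued fractions

Seq : Set
Seq = ℕ → ℕ

Pos : Seq → Set
Pos a = ∀ i → NonZero (a i)

inv : ∀ x → .{{Positive x}} → ℚ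
inv x = (ℚ.1/ x) {{ℚ.pos⇒nonZero x}}

inv-antimono-< : ∀ x y .{{_ : Positive x}} .{{_ : Positive y}} →
                 x ℚ.< y → inv y ℚ.< inv x
inv-antimono-< (mkℚ (ℤ.+[1+ m ]) d _) (mkℚ (ℤ.+[1+ n ]) e _) (*<* p) =
  *<* (subst₂ ℤ._<_ (ℤ.*-comm ℤ.+[1+ m ] ℤ.+[1+ e ]) (ℤ.*-comm ℤ.+[1+ n ] ℤ.+[1+ d ]) p)

inv-cancel-< : ∀ x y .{{_ : Positive x}} .{{_ : Positive y}} →
               inv y ℚ.< inv x → x ℚ.< y
inv-cancel-< (mkℚ (ℤ.+[1+ m ]) d _) (mkℚ (ℤ.+[1+ n ]) e _) (*<* p) =
  *<* (subst₂ ℤ._<_ (ℤ.*-comm ℤ.+[1+ e ] ℤ.+[1+ m ]) (ℤ.*-comm ℤ.+[1+ d ] ℤ.+[1+ n ]) p)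

inv-≤1 : ∀ x .{{_ : Positive x}} → 1ℚ ℚ.≤ x → inv x ℚ.≤ 1ℚ
inv-≤1 (mkℚ (ℤ.+[1+ m ]) d _) (*≤* p) =
  *≤* (subst₂ ℤ._≤_ (ℤ.*-comm 1ℤ ℤ.+[1+ d ]) (ℤ.*-comm ℤ.+[1+ m ] 1ℤ) p)

p<p+q : ∀ p q .{{_ : Positive q}} → p ℚ.< p ℚ.+ q
p<p+q p q = subst (ℚ._< p ℚ.+ q) (ℚ.+-identityʳ p) (ℚ.+-monoʳ-< p (ℚ.positive⁻¹ q))

+-cancelˡ-< : ∀ r {p q} → r ℚ.+ p ℚ.< r ℚ.+ q → p ℚ.< q
+-cancelˡ-< r {p} {q} lt = subst₂ ℚ._<_ (e p) (e q) (ℚ.+-monoʳ-< (ℚ.- r) lt)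
  where
  e : ∀ x → ℚ.- r ℚ.+ (r ℚ.+ x) ≡ x
  e x = trans (sym (ℚ.+-assoc (ℚ.- r) r x))
       (trans (cong (ℚ._+ x) (ℚ.+-inverseˡ r)) (ℚ.+-identityˡ x))

module _ (a : Seq) (a⁺ : Pos a) where

  private
    tail  = cf (a ∘ suc) (a⁺ ∘ suc)
    tail⁺ = cf-pos (a ∘ suc) (a⁺ ∘ suc)

  cf-suc-antimono : ∀ i j → tail i ℚ.< tail j → cf a a⁺ (suc j) ℚ.< cf a a⁺ (suc i)
  cf-suc-antimono i j p = ℚ.+-monoʳ-< (+ a 0 / 1)
    (inv-antimono-< (tail i) (tail j) {{tail⁺ i}} {{tail⁺ j}} p)

-- The initial term is exceeded by every longer convergent; passing from the tail to its inverse
-- reverses an inequality, which is the swap made by `alt`.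
cf-alternates : ∀ a (a⁺ : Pos a) k j → k ℕ.< j → alt ℚ._<_ k (cf a a⁺ k) (cf a a⁺ j)
cf-alternates a a⁺ zero (suc j) _ =
  p<p+q (+ a 0 / 1) _ {{ℚ.1/pos⇒pos (cf (a ∘ suc) (a⁺ ∘ suc) j) {{cf-pos (a ∘ suc) (a⁺ ∘ suc) j}}}}
cf-alternates a a⁺ (suc k) (suc j) (ℕ.s≤s k<j) =
  alt-map (cf-suc-antimono a a⁺ k j) (cf-suc-antimono a a⁺ j k) k
    (cf-alternates (a ∘ suc) (a⁺ ∘ suc) k j k<j)

fromℕ : ℕ → ℚ
fromℕ n = mkℚ (+ n) 0 (Coprimality.sym (Coprimality.1-coprimeTo n))

n/1≡fromℕ : ∀ n → + n / 1 ≡ fromℕ n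
n/1≡fromℕ n = ℚ.normalize-coprime {n} {0} (Coprimality.sym (Coprimality.1-coprimeTo n))

fromℕ-suc : ∀ n → fromℕ n ℚ.+ 1ℚ ≡ fromℕ (suc n)
fromℕ-suc n = trans
  (cong (_/ 1) (trans (cong (ℤ._+ 1ℤ) (ℤ.*-identityʳ (+ n))) (cong +_ (ℕ.+-comm n 1))))
  (n/1≡fromℕ (suc n))

fromℕ-cancel-< : ∀ {m n} → fromℕ m ℚ.< fromℕ n → m ℕ.< n
fromℕ-cancel-< {m} {n} (*<* p) =
  ℤ.drop‿+<+ (subst₂ ℤ._<_ (ℤ.*-identityʳ (+ m)) (ℤ.*-identityʳ (+ n)) p)

fromℕ-mono-≤ : ∀ {m n} → m ≤ n → fromℕ m ℚ.≤ fromℕ n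
fromℕ-mono-≤ {m} {n} p =
  *≤* (subst₂ ℤ._≤_ (sym (ℤ.*-identityʳ (+ m))) (sym (ℤ.*-identityʳ (+ n))) (ℤ.+≤+ p))

module _ {a a′ : Seq} (a⁺ : Pos a) (a′⁺ : Pos a′) where

  cf0<x1⇒≤ : cf a a⁺ 0 ℚ.< cf a′ a′⁺ 1 → a 0 ≤ a′ 0
  cf0<x1⇒≤ lt = ℕ.≤-pred (fromℕ-cancel-< (begin-strict
    fromℕ (a 0)              ≡⟨ n/1≡fromℕ (a 0) ⟨
    + a 0 / 1                <⟨ lt ⟩
    + a′ 0 / 1 ℚ.+ inv x {{x⁺}} ≤⟨ ℚ.+-monoʳ-≤ (+ a′ 0 / 1) (inv-≤1 x {{x⁺}} 1≤x) ⟩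
    + a′ 0 / 1 ℚ.+ 1ℚ        ≡⟨ cong (ℚ._+ 1ℚ) (n/1≡fromℕ (a′ 0)) ⟩
    fromℕ (a′ 0) ℚ.+ 1ℚ      ≡⟨ fromℕ-suc (a′ 0) ⟩
    fromℕ (suc (a′ 0))       ∎))
    where
    open ℚ.≤-Reasoning
    x   = cf (a′ ∘ suc) (a′⁺ ∘ suc) 0
    x⁺  = cf-pos (a′ ∘ suc) (a′⁺ ∘ suc) 0
    1≤x : 1ℚ ℚ.≤ x
    1≤x = subst (1ℚ ℚ.≤_) (sym (n/1≡fromℕ (a′ 1)))
            (fromℕ-mono-≤ (ℕ.>-nonZero⁻¹ (a′ 1) {{a′⁺ 1}}))

  cf-suc-cancel : a 0 ≡ a′ 0 → ∀ i j → cf a a⁺ (suc i) ℚ.< cf a′ a′⁺ (suc j) →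
                  cf (a′ ∘ suc) (a′⁺ ∘ suc) j ℚ.< cf (a ∘ suc) (a⁺ ∘ suc) i
  cf-suc-cancel eq i j lt =
    inv-cancel-< _ _ {{cf-pos (a′ ∘ suc) (a′⁺ ∘ suc) j}} {{cf-pos (a ∘ suc) (a⁺ ∘ suc) i}}
      (+-cancelˡ-< (+ a 0 / 1) {inv x {{x⁺}}} {inv y {{y⁺}}}
        (subst (λ n → + a 0 / 1 ℚ.+ inv x {{x⁺}} ℚ.< + n / 1 ℚ.+ inv y {{y⁺}}) (sym eq) lt))
    where
    x   = cf (a ∘ suc) (a⁺ ∘ suc) i
    x⁺  = cf-pos (a ∘ suc) (a⁺ ∘ suc) i
    y   = cf (a′ ∘ suc) (a′⁺ ∘ suc) j
    y⁺  = cf-pos (a′ ∘ suc) (a′⁺ ∘ suc) j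

-- A convergent with index 1 exceeds its initial term by at most 1, so index 0 of the two hypotheses
-- bounds each initial term by the other. Cancelling the common term and inverting turns the
-- hypotheses at `suc k` into those at `k` for the tails.
interleaved⇒≗ : ∀ {a a′ : Seq} (a⁺ : Pos a) (a′⁺ : Pos a′) →
  (∀ k → alt ℚ._<_ k (cf a a⁺ k) (cf a′ a′⁺ (suc k))) →
  (∀ k → alt ℚ._<_ k (cf a′ a′⁺ k) (cf a a⁺ (suc k))) →
  ∀ i → a i ≡ a′ i
interleaved⇒≗ {a} {a′} a⁺ a′⁺ p q = λ where
    zero    → a0≡
    (suc i) → interleaved⇒≗ (a⁺ ∘ suc) (a′⁺ ∘ suc)
      (λ k → alt-map (cf-suc-cancel a′⁺ a⁺ (sym a0≡) (suc k) k) (cf-suc-cancel a⁺ a′⁺ a0≡ k (suc k)) k (p (suc k)))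
      (λ k → alt-map (cf-suc-cancel a⁺ a′⁺ a0≡ (suc k) k) (cf-suc-cancel a′⁺ a⁺ (sym a0≡) k (suc k)) k (q (suc k)))
      i
  where
  a0≡ : a 0 ≡ a′ 0
  a0≡ = ℕ.≤-antisym (cf0<x1⇒≤ a⁺ a′⁺ (p 0)) (cf0<x1⇒≤ a′⁺ a⁺ (q 0))

-- From convergence to comparisons of squares

square-mono-< : ∀ {x y} → 0ℚ ℚ.< x → x ℚ.< y → x ℚ.* x ℚ.< y ℚ.* y
square-mono-< {x} {y} 0<x x<y = ℚ.<-trans
  (ℚ.*-monoʳ-<-pos x {{ℚ.positive 0<x}} x<y)
  (ℚ.*-monoˡ-<-pos y {{ℚ.positive (ℚ.<-trans 0<x x<y)}} x<y)

square-mono-≤ : ∀ {x y} → 0ℚ ℚ.≤ x → x ℚ.≤ y → x ℚ.* x ℚ.≤ y ℚ.* y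
square-mono-≤ {x} {y} 0≤x x≤y = ℚ.≤-trans
  (ℚ.*-monoʳ-≤-nonNeg x {{ℚ.nonNegative 0≤x}} x≤y)
  (ℚ.*-monoˡ-≤-nonNeg y {{ℚ.nonNegative (ℚ.≤-trans 0≤x x≤y)}} x≤y)

square-cancel-< : ∀ {x y} → 0ℚ ℚ.≤ y → x ℚ.* x ℚ.< y ℚ.* y → x ℚ.< y
square-cancel-< 0≤y x²<y² = ℚ.≰⇒> λ y≤x → ℚ.<-irrefl refl (ℚ.<-≤-trans x²<y² (square-mono-≤ 0≤y y≤x))

0<q-p : ∀ {p q} → p ℚ.< q → 0ℚ ℚ.< q ℚ.- p
0<q-p {p} {q} p<q = subst (ℚ._< q ℚ.- p) (ℚ.+-inverseʳ p) (ℚ.+-monoˡ-< (ℚ.- p) p<q)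

p+[q-p]≡q : ∀ p q → p ℚ.+ (q ℚ.- p) ≡ q
p+[q-p]≡q p q = trans (cong (p ℚ.+_) (ℚ.+-comm q (ℚ.- p)))
  (trans (sym (ℚ.+-assoc p (ℚ.- p) q))
  (trans (cong (ℚ._+ q) (ℚ.+-inverseʳ p)) (ℚ.+-identityˡ q)))

q-[q-p]≡p : ∀ p q → q ℚ.- (q ℚ.- p) ≡ p
q-[q-p]≡p p q = trans (cong (q ℚ.+_) (trans (ℚ.neg-distrib-+ q (ℚ.- p))
    (trans (ℚ.+-comm (ℚ.- q) (ℚ.- (ℚ.- p))) (cong (ℚ._- q) (⁻¹-involutive ℚ.+-0-group p)))))
  (p+[q-p]≡q q p)

<√-weaken : ∀ {x y z ρ} → 0ℚ ℚ.< x → y ℚ.< z → z ℚ.- (y ℚ.- x) <√ ρ → x ℚ.* x ℚ.< ρ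
<√-weaken {x} {y} {z} 0<x y<z = λ where
    (inj₁ neg) → contradiction (ℚ.<-trans (ℚ.<-trans 0<x x<z-ε) neg) (ℚ.<-irrefl refl)
    (inj₂ sq)  → ℚ.<-trans (square-mono-< 0<x x<z-ε) sq
  where
  x<z-ε : x ℚ.< z ℚ.- (y ℚ.- x)
  x<z-ε = subst (ℚ._< z ℚ.- (y ℚ.- x)) (q-[q-p]≡p x y) (ℚ.+-monoˡ-< (ℚ.- (y ℚ.- x)) y<z)

√<-weaken : ∀ {x y z ρ} → z ℚ.< y → √ ρ < z ℚ.+ (x ℚ.- y) → ρ ℚ.< x ℚ.* x
√<-weaken {x} {y} {z} z<y (0<z+ε , sq) = ℚ.<-trans sq (square-mono-< 0<z+ε
  (subst (z ℚ.+ (x ℚ.- y) ℚ.<_) (p+[q-p]≡q y x) (ℚ.+-monoˡ-< (x ℚ.- y) z<y)))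

Straddles : ℚ → (ℕ → ℚ) → ℕ → Set
Straddles ρ x k = alt ℚ._<_ k (x k ℚ.* x k) ρ

module Alternating (x : ℕ → ℚ) (0<x : ∀ k → 0ℚ ℚ.< x k)
                   (alternates : ∀ k j → k ℕ.< j → alt ℚ._<_ k (x k) (x j)) where

  -- The value `x (2 + k)` lies strictly between `x k` and every later `x j`. With ε the gap between
  -- `x k` and `x (2 + k)`, moving `x j` towards `x k` by ε does not reach `x k`, so the root is
  -- strictly beyond `x k`.
  converges⇒straddles : ∀ {ρ} →
    (∀ ε → 0ℚ ℚ.< ε → ∃[ N ] ∀ k → N ≤ k → (x k ℚ.- ε <√ ρ) × (√ ρ < x k ℚ.+ ε)) →
    ∀ k → Straddles ρ x k
  converges⇒straddles {ρ} x→√ρ k with x~y ← alternates k (2 ℕ.+ k) (ℕ.m<n+m k (ℕ.s≤s ℕ.z≤n)) with alt-parity k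
  ... | inj₁ even = proj₂ even (<√-weaken {x k} (0<x k) (proj₁ even y~z) (proj₁ (proj₂ near j (ℕ.m≤n+m _ (3 ℕ.+ k)))))
    where
    near = x→√ρ (x (2 ℕ.+ k) ℚ.- x k) (0<q-p (proj₁ even x~y))
    j = 3 ℕ.+ k ℕ.+ proj₁ near
    y~z = alternates (2 ℕ.+ k) j (ℕ.m≤m+n (3 ℕ.+ k) _)
  ... | inj₂ odd = proj₂ odd (√<-weaken {x k} (proj₁ odd y~z) (proj₂ (proj₂ near j (ℕ.m≤n+m _ (3 ℕ.+ k)))))
    where
    near = x→√ρ (x k ℚ.- x (2 ℕ.+ k)) (0<q-p (proj₁ odd x~y))
    j = 3 ℕ.+ k ℕ.+ proj₁ near
    y~z = alternates (2 ℕ.+ k) j (ℕ.m≤m+n (3 ℕ.+ k) _)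

  straddles-step : ∀ {ρ} k → Straddles ρ x (2 ℕ.+ k) → Straddles ρ x k
  straddles-step k = alt-trans ℚ.<-trans k
    (alt-map (square-mono-< {x k} (0<x k)) (square-mono-< {x (2 ℕ.+ k)} (0<x (2 ℕ.+ k))) k
      (alternates k (2 ℕ.+ k) (ℕ.m<n+m k (ℕ.s≤s ℕ.z≤n))))

  -- A single step links indices of the same parity only; therefore two consecutive indices are
  -- carried along.
  straddles-down : ∀ {ρ} d k → Straddles ρ x (d ℕ.+ k) → Straddles ρ x (suc d ℕ.+ k) → Straddles ρ x k
  straddles-down zero    k p q = p
  straddles-down (suc d) k p q = straddles-down d k (straddles-step (d ℕ.+ k) q) p

straddles-interleave : ∀ {ρ} {x y : ℕ → ℚ} → (∀ k → 0ℚ ℚ.< x k) → (∀ k → 0ℚ ℚ.< y k) →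
  (∀ k → Straddles ρ x k) → (∀ k → Straddles ρ y k) →
  ∀ k → alt ℚ._<_ k (x k) (y (suc k))
straddles-interleave {x = x} {y} 0<x 0<y p q k = alt-map
  (square-cancel-< {x k} (ℚ.<⇒≤ (0<y (suc k)))) (square-cancel-< {y (suc k)} (ℚ.<⇒≤ (0<x k))) k
  (alt-trans ℚ.<-trans k (p k) (q (suc k)))

0<cf : ∀ a (a⁺ : Pos a) k → 0ℚ ℚ.< cf a a⁺ k
0<cf a a⁺ k = ℚ.positive⁻¹ (cf a a⁺ k) {{cf-pos a a⁺ k}}

straddles-unique : ∀ {ρ a a′} (a⁺ : Pos a) (a′⁺ : Pos a′) →
  (∀ k → Straddles ρ (cf a a⁺) k) → (∀ k → Straddles ρ (cf a′ a′⁺) k) → ∀ i → a i ≡ a′ i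
straddles-unique {ρ} {a} {a′} a⁺ a′⁺ p q = interleaved⇒≗ a⁺ a′⁺
  (straddles-interleave {ρ} {cf a a⁺} {cf a′ a′⁺} (0<cf a a⁺) (0<cf a′ a′⁺) p q)
  (straddles-interleave {ρ} {cf a′ a′⁺} {cf a a⁺} (0<cf a′ a′⁺) (0<cf a a⁺) q p)

-- Convergents as columns of matrix products

step : ℕ → ℕ × ℕ → ℕ × ℕ
step c (x , y) = c * x ℕ.+ y , x

-- The product of the matrices (a i , 1 ; 1 , 0) for i < n, applied to a vector.
act : Seq → ℕ → ℕ × ℕ → ℕ × ℕ
act a zero    v = v
act a (suc n) v = step (a 0) (act (a ∘ suc) n v)

-- Numerator and denominator of the convergent with index n - 1.
col : Seq → ℕ → ℕ × ℕ
col a n = act a n (1 , 0)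

-- A common divisor of `m * p + q` and `p` divides `q`, so the sum is already in lowest terms and
-- nothing cancels. This is why matrix columns give the reduced numerators and denominators.
fromℕ+inv : ∀ m x .{{_ : Positive x}} {p q} → ↥ x ≡ + p → ↧ₙ x ≡ q →
            (↥ (fromℕ m ℚ.+ inv x) ≡ + (m * p ℕ.+ q)) × (↧ₙ (fromℕ m ℚ.+ inv x) ≡ p)
fromℕ+inv m (mkℚ (ℤ.+[1+ n ]) d c) refl refl = cong ↥_ sum , cong ↧ₙ_ sum
  where
  coprime : .(Coprime (suc n) (suc d)) → Coprime (m * suc n ℕ.+ suc d) (suc n)
  coprime c (i∣s , i∣n) =
    Coprimality.recompute c (i∣n , ∣m+n∣m⇒∣n i∣s (∣n⇒∣m*n m i∣n))
  sum : fromℕ m ℚ.+ inv (mkℚ (ℤ.+[1+ n ]) d c) ≡ mkℚ (+ (m * suc n ℕ.+ suc d)) n (coprime c)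
  sum = trans
    (ℚ./-cong {p₁ = + m ℤ.* ℤ.+[1+ n ] ℤ.+ ℤ.+[1+ d ] ℤ.* 1ℤ}
      (cong₂ ℤ._+_ (sym (ℤ.pos-* m (suc n))) (ℤ.*-identityʳ ℤ.+[1+ d ]))
      (ℕ.*-identityˡ (suc n)))
    (ℚ.normalize-coprime (coprime c))

cf-col : ∀ a (a⁺ : Pos a) k →
         (↥ cf a a⁺ k ≡ + proj₁ (col a (suc k))) × (↧ₙ cf a a⁺ k ≡ proj₂ (col a (suc k)))
cf-col a a⁺ zero =
  trans (cong ↥_ (n/1≡fromℕ (a 0))) (cong +_ (sym (trans (ℕ.+-identityʳ _) (ℕ.*-identityʳ (a 0))))) ,
  cong ↧ₙ_ (n/1≡fromℕ (a 0))
cf-col a a⁺ (suc k) = subst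
  (λ z → (↥ (z ℚ.+ inv x {{x⁺}}) ≡ + proj₁ (col a (2 ℕ.+ k))) × (↧ₙ (z ℚ.+ inv x {{x⁺}}) ≡ proj₂ (col a (2 ℕ.+ k))))
  (sym (n/1≡fromℕ (a 0)))
  (fromℕ+inv (a 0) x {{x⁺}} (proj₁ rec) (proj₂ rec))
  where
  x = cf (a ∘ suc) (a⁺ ∘ suc) k
  x⁺ = cf-pos (a ∘ suc) (a⁺ ∘ suc) k
  rec = cf-col (a ∘ suc) (a⁺ ∘ suc) k

-- Signs of the quadratic form at the convergents

form : (D Q : ℕ) → ℕ × ℕ → ℤ
form D Q (x , y) = + Q ℤ.* (+ x ℤ.* + x) ℤ.- + D ℤ.* (+ y ℤ.* + y)

sign : ℕ → ℤ
sign zero    = 1ℤ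
sign (suc n) = ℤ.- sign n

alt⇒sign : ∀ k {u v} → alt ℤ._<_ k u v → 0ℤ ℤ.< sign (suc k) ℤ.* (u ℤ.- v)
alt⇒sign zero {u} {v} u<v = subst₂ ℤ._<_ (ℤ.+-inverseʳ u) (eq u v) (ℤ.+-monoˡ-< (ℤ.- u) u<v)
  where
  eq : ∀ u v → v ℤ.- u ≡ ℤ.- 1ℤ ℤ.* (u ℤ.- v)
  eq = ℤ-ring.solve-∀
alt⇒sign (suc k) {u} {v} p = subst (0ℤ ℤ.<_) (eq (sign (suc k)) u v) (alt⇒sign k p)
  where
  eq : ∀ s u v → s ℤ.* (v ℤ.- u) ≡ ℤ.- s ℤ.* (u ℤ.- v)
  eq = ℤ-ring.solve-∀

sign⇒alt : ∀ k {u v} → 0ℤ ℤ.< sign (suc k) ℤ.* (u ℤ.- v) → alt ℤ._<_ k u v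
sign⇒alt zero {u} {v} p = subst₂ ℤ._<_ (ℤ.+-identityˡ u) (eq u v) (ℤ.+-monoˡ-< u p)
  where
  eq : ∀ u v → ℤ.- 1ℤ ℤ.* (u ℤ.- v) ℤ.+ u ≡ v
  eq = ℤ-ring.solve-∀
sign⇒alt (suc k) {u} {v} p = sign⇒alt k (subst (0ℤ ℤ.<_) (eq (sign (suc k)) u v) p)
  where
  eq : ∀ s u v → ℤ.- s ℤ.* (u ℤ.- v) ≡ s ℤ.* (v ℤ.- u)
  eq = ℤ-ring.solve-∀

module _ (D Q : ℕ) .{{_ : NonZero Q}} (x : ℚ) {p q : ℕ} (p≡ : ↥ x ≡ + p) (q≡ : ↧ₙ x ≡ q) where

  private
    X  = ℚ.toℚᵘ x ℚᵘ.* ℚ.toℚᵘ x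

    X≃ : ℚ.toℚᵘ (x ℚ.* x) ℚᵘ.≃ X
    X≃ = ℚ.toℚᵘ-homo-* x x

    ρ≃ : ℚ.toℚᵘ (+ D / Q) ℚᵘ.≃ (+ D ℚᵘ./ Q)
    ρ≃ = go Q
      where
      go : ∀ Q .{{_ : NonZero Q}} → ℚ.toℚᵘ (+ D / Q) ℚᵘ.≃ (+ D ℚᵘ./ Q)
      go (suc Q) = ℚ.toℚᵘ-fromℚᵘ (ℚᵘ.mkℚᵘ (+ D) Q)

    ↥X : ℚᵘ.↥ X ≡ + p ℤ.* + p
    ↥X = trans (homo x) (cong₂ ℤ._*_ p≡ p≡)
      where
      homo : ∀ y → ℚᵘ.↥ (ℚ.toℚᵘ y ℚᵘ.* ℚ.toℚᵘ y) ≡ ↥ y ℤ.* ↥ y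
      homo record{} = refl

    ↧X : ℚᵘ.↧ X ≡ + q ℤ.* + q
    ↧X = trans (homo x) (trans (ℤ.pos-* (↧ₙ x) (↧ₙ x)) (cong₂ (λ m n → + m ℤ.* + n) q≡ q≡))
      where
      homo : ∀ y → ℚᵘ.↧ (ℚ.toℚᵘ y ℚᵘ.* ℚ.toℚᵘ y) ≡ + (↧ₙ y * ↧ₙ y)
      homo record{} = refl

    ↧ρ : ℚᵘ.↧ (+ D ℚᵘ./ Q) ≡ + Q
    ↧ρ = ℚᵘ.↧[n/d]≡d (+ D) Q

    ↥ρ : ℚᵘ.↥ (+ D ℚᵘ./ Q) ≡ + D
    ↥ρ = ℚᵘ.↥[n/d]≡n (+ D) Q

    lhs : ℚᵘ.↥ X ℤ.* ℚᵘ.↧ (+ D ℚᵘ./ Q) ≡ + Q ℤ.* (+ p ℤ.* + p)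
    lhs = trans (cong₂ ℤ._*_ ↥X ↧ρ) (ℤ.*-comm (+ p ℤ.* + p) (+ Q))

    rhs : ℚᵘ.↥ (+ D ℚᵘ./ Q) ℤ.* ℚᵘ.↧ X ≡ + D ℤ.* (+ q ℤ.* + q)
    rhs = cong₂ ℤ._*_ ↥ρ ↧X

  <ρ⇒form : x ℚ.* x ℚ.< + D / Q → + Q ℤ.* (+ p ℤ.* + p) ℤ.< + D ℤ.* (+ q ℤ.* + q)
  <ρ⇒form lt = subst₂ ℤ._<_ lhs rhs (ℚᵘ.drop-*<*
    (ℚᵘ.<-respʳ-≃ ρ≃ (ℚᵘ.<-respˡ-≃ X≃ (ℚ.toℚᵘ-mono-< lt))))

  ρ<⇒form : + D / Q ℚ.< x ℚ.* x → + D ℤ.* (+ q ℤ.* + q) ℤ.< + Q ℤ.* (+ p ℤ.* + p)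
  ρ<⇒form lt = subst₂ ℤ._<_ rhs lhs (ℚᵘ.drop-*<*
    (ℚᵘ.<-respʳ-≃ X≃ (ℚᵘ.<-respˡ-≃ ρ≃ (ℚ.toℚᵘ-mono-< lt))))

  form⇒<ρ : + Q ℤ.* (+ p ℤ.* + p) ℤ.< + D ℤ.* (+ q ℤ.* + q) → x ℚ.* x ℚ.< + D / Q
  form⇒<ρ lt = ℚ.toℚᵘ-cancel-< (ℚᵘ.<-respʳ-≃ (ℚᵘ.≃-sym ρ≃) (ℚᵘ.<-respˡ-≃ (ℚᵘ.≃-sym X≃)
    (ℚᵘ.*<* (subst₂ ℤ._<_ (sym lhs) (sym rhs) lt))))

  form⇒ρ< : + D ℤ.* (+ q ℤ.* + q) ℤ.< + Q ℤ.* (+ p ℤ.* + p) → + D / Q ℚ.< x ℚ.* x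
  form⇒ρ< lt = ℚ.toℚᵘ-cancel-< (ℚᵘ.<-respʳ-≃ (ℚᵘ.≃-sym X≃) (ℚᵘ.<-respˡ-≃ (ℚᵘ.≃-sym ρ≃)
    (ℚᵘ.*<* (subst₂ ℤ._<_ (sym rhs) (sym lhs) lt))))

module _ (D Q : ℕ) .{{_ : NonZero Q}} {a : Seq} (a⁺ : Pos a) where

  straddles⇒form : ∀ k → Straddles (+ D / Q) (cf a a⁺) k →
                   0ℤ ℤ.< sign (suc k) ℤ.* form D Q (col a (suc k))
  straddles⇒form k p = alt⇒sign k (alt-map
    (<ρ⇒form D Q (cf a a⁺ k) (proj₁ (cf-col a a⁺ k)) (proj₂ (cf-col a a⁺ k)))
    (ρ<⇒form D Q (cf a a⁺ k) (proj₁ (cf-col a a⁺ k)) (proj₂ (cf-col a a⁺ k))) k p)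

  form⇒straddles : ∀ k → 0ℤ ℤ.< sign (suc k) ℤ.* form D Q (col a (suc k)) →
                   Straddles (+ D / Q) (cf a a⁺) k
  form⇒straddles k p = alt-map
    (form⇒<ρ D Q (cf a a⁺ k) (proj₁ (cf-col a a⁺ k)) (proj₂ (cf-col a a⁺ k)))
    (form⇒ρ< D Q (cf a a⁺ k) (proj₁ (cf-col a a⁺ k)) (proj₂ (cf-col a a⁺ k))) k (sign⇒alt k p)

-- Linearity, determinants and growth of the columns

act-cong : ∀ {a a′} → (∀ i → a i ≡ a′ i) → ∀ n v → act a n v ≡ act a′ n v
act-cong a≗a′ zero    v = refl
act-cong a≗a′ (suc n) v = cong₂ step (a≗a′ 0) (act-cong (a≗a′ ∘ suc) n v)

act-+ : ∀ a m n v → act a (m ℕ.+ n) v ≡ act a m (act (λ i → a (m ℕ.+ i)) n v)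
act-+ a zero    n v = refl
act-+ a (suc m) n v = cong (step (a 0)) (act-+ (a ∘ suc) m n v)

apply : ℕ × ℕ → ℕ × ℕ → ℕ × ℕ → ℕ × ℕ
apply (r , s) (t , u) (x , y) = r * x ℕ.+ t * y , s * x ℕ.+ u * y

act-linear : ∀ a n v → act a n v ≡ apply (act a n (1 , 0)) (act a n (0 , 1)) v
act-linear a zero (x , y) = cong₂ _,_ (eq₁ x y) (eq₂ x y)
  where
  eq₁ : ∀ x y → x ≡ 1 * x ℕ.+ 0 * y
  eq₁ = ℕ-ring.solve-∀
  eq₂ : ∀ x y → y ≡ 0 * x ℕ.+ 1 * y
  eq₂ = ℕ-ring.solve-∀
act-linear a (suc n) v@(x , y) = trans (cong (step (a 0)) (act-linear (a ∘ suc) n v))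
  (cong (_, proj₁ p * x ℕ.+ proj₁ q * y) (eq (a 0) x y (proj₁ p) (proj₂ p) (proj₁ q) (proj₂ q)))
  where
  p = act (a ∘ suc) n (1 , 0)
  q = act (a ∘ suc) n (0 , 1)
  eq : ∀ c x y r s t u → c * (r * x ℕ.+ t * y) ℕ.+ (s * x ℕ.+ u * y) ≡ (c * r ℕ.+ s) * x ℕ.+ (c * t ℕ.+ u) * y
  eq = ℕ-ring.solve-∀

cross : ℕ × ℕ → ℕ × ℕ → ℤ
cross (x , y) (z , w) = + x ℤ.* + w ℤ.- + z ℤ.* + y

pos-linear : ∀ c x y → + (c * x ℕ.+ y) ≡ + c ℤ.* + x ℤ.+ + y
pos-linear c x y = cong (ℤ._+ + y) (ℤ.pos-* c x)

pos-bilinear : ∀ r x t y → + (r * x ℕ.+ t * y) ≡ + r ℤ.* + x ℤ.+ + t ℤ.* + y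
pos-bilinear r x t y = cong₂ ℤ._+_ (ℤ.pos-* r x) (ℤ.pos-* t y)

cross-step : ∀ c v w → cross (step c v) (step c w) ≡ ℤ.- cross v w
cross-step c (x , y) (z , w) = trans
  (cong₂ (λ i j → i ℤ.* + z ℤ.- j ℤ.* + x) (pos-linear c x y) (pos-linear c z w))
  (eq (+ c) (+ x) (+ y) (+ z) (+ w))
  where
  eq : ∀ c x y z w → (c ℤ.* x ℤ.+ y) ℤ.* z ℤ.- (c ℤ.* z ℤ.+ w) ℤ.* x ≡ ℤ.- (x ℤ.* w ℤ.- z ℤ.* y)
  eq = ℤ-ring.solve-∀

cross-act : ∀ a n v w → cross (act a n v) (act a n w) ≡ sign n ℤ.* cross v w
cross-act a zero    v w = sym (ℤ.*-identityˡ (cross v w))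
cross-act a (suc n) v w = begin
  cross (act a (suc n) v) (act a (suc n) w)                   ≡⟨ cross-step (a 0) (act (a ∘ suc) n v) (act (a ∘ suc) n w) ⟩
  ℤ.- cross (act (a ∘ suc) n v) (act (a ∘ suc) n w)           ≡⟨ cong ℤ.-_ (cross-act (a ∘ suc) n v w) ⟩
  ℤ.- (sign n ℤ.* cross v w)                                  ≡⟨ ℤ.neg-distribˡ-* (sign n) (cross v w) ⟩
  ℤ.- sign n ℤ.* cross v w                                    ∎
  where open ≡-Reasoning

cross-col : ∀ a n → cross (col a n) (col a (suc n)) ≡ sign n
cross-col a zero    = cong (λ n → 1ℤ ℤ.* 1ℤ ℤ.- n) (ℤ.*-zeroʳ (+ (a 0 * 1 ℕ.+ 0)))
cross-col a (suc n) = trans (cross-step (a 0) (col (a ∘ suc) n) (col (a ∘ suc) (suc n)))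
  (cong ℤ.-_ (cross-col (a ∘ suc) n))

∣sign∣≡1 : ∀ n → ℤ.∣ sign n ∣ ≡ 1
∣sign∣≡1 zero    = refl
∣sign∣≡1 (suc n) = trans (ℤ.∣-i∣≡∣i∣ (sign n)) (∣sign∣≡1 n)

sign*sign : ∀ n → sign n ℤ.* sign n ≡ 1ℤ
sign*sign zero    = refl
sign*sign (suc n) = trans (eq (sign n)) (sign*sign n)
  where
  eq : ∀ s → (ℤ.- s) ℤ.* (ℤ.- s) ≡ s ℤ.* s
  eq = ℤ-ring.solve-∀

0<num : ∀ a (a⁺ : Pos a) n → 0 ℕ.< proj₁ (col a n)
0<num a a⁺ zero    = ℕ.s≤s ℕ.z≤n
0<num a a⁺ (suc n) = ℕ.≤-trans
  (ℕ.*-mono-≤ (ℕ.>-nonZero⁻¹ (a 0) {{a⁺ 0}}) (0<num (a ∘ suc) (a⁺ ∘ suc) n)) (ℕ.m≤m+n _ _)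

-- The denominator of a column is the numerator of a column of the tail, so this also makes the
-- denominators unbounded.
n≤num : ∀ a (a⁺ : Pos a) n → n ≤ proj₁ (col a n)
n≤num a a⁺ zero          = ℕ.z≤n
n≤num a a⁺ (suc zero)    = 0<num a a⁺ 1
n≤num a a⁺ (suc (suc n)) = begin
  suc (suc n)                                 ≡⟨ ℕ.+-comm 1 (suc n) ⟩
  suc n ℕ.+ 1                                 ≤⟨ ℕ.+-mono-≤ (n≤num a₁ (a⁺ ∘ suc) (suc n)) (0<num (a₁ ∘ suc) (a⁺ ∘ suc ∘ suc) n) ⟩
  proj₁ (col a₁ (suc n)) ℕ.+ proj₂ (col a₁ (suc n))
    ≤⟨ ℕ.+-monoˡ-≤ _ (ℕ.m≤n*m (proj₁ (col a₁ (suc n))) (a 0) {{a⁺ 0}}) ⟩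
  a 0 * proj₁ (col a₁ (suc n)) ℕ.+ proj₂ (col a₁ (suc n)) ∎
  where
  open ℕ.≤-Reasoning
  a₁ = a ∘ suc

col-mono-suc : ∀ a (a⁺ : Pos a) n →
  (proj₁ (col a n) ≤ proj₁ (col a (suc n))) × (proj₂ (col a n) ≤ proj₂ (col a (suc n)))
col-mono-suc a a⁺ zero    = 0<num a a⁺ 1 , ℕ.z≤n
col-mono-suc a a⁺ (suc n) = ℕ.+-mono-≤ (ℕ.*-monoʳ-≤ (a 0) (proj₁ rec)) (proj₂ rec) , proj₁ rec
  where rec = col-mono-suc (a ∘ suc) (a⁺ ∘ suc) n

col-mono : ∀ a (a⁺ : Pos a) {m n} → m ≤ n →
  (proj₁ (col a m) ≤ proj₁ (col a n)) × (proj₂ (col a m) ≤ proj₂ (col a n))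
col-mono a a⁺ {m} m≤n = go (ℕ.≤⇒≤′ m≤n)
  where
  go : ∀ {n} → m ℕ.≤′ n → (proj₁ (col a m) ≤ proj₁ (col a n)) × (proj₂ (col a m) ≤ proj₂ (col a n))
  go ℕ.≤′-refl           = ℕ.≤-refl , ℕ.≤-refl
  go (ℕ.≤′-step {n} m≤n) =
    ℕ.≤-trans (proj₁ (go m≤n)) (proj₁ (col-mono-suc a a⁺ n)) ,
    ℕ.≤-trans (proj₂ (go m≤n)) (proj₂ (col-mono-suc a a⁺ n))

-- Periodic expansions and their period matrix

lookup-∷ʳ-inject₁ : ∀ {k} {A : Set} (xs : Vec A k) z i → lookup (xs ∷ʳ z) (inject₁ i) ≡ lookup xs i
lookup-∷ʳ-inject₁ (x ∷ xs) z fzero    = refl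
lookup-∷ʳ-inject₁ (x ∷ xs) z (fsuc i) = lookup-∷ʳ-inject₁ xs z i

lookup-∷ʳ-last : ∀ {k} {A : Set} (xs : Vec A k) z → lookup (xs ∷ʳ z) (maxFin k) ≡ z
lookup-∷ʳ-last []       z = refl
lookup-∷ʳ-last (x ∷ xs) z = lookup-∷ʳ-last xs z

mod-cong : ∀ i j {k} → i % suc k ≡ j % suc k → i mod suc k ≡ j mod suc k
mod-cong i j {k} eq = Fin.fromℕ<-cong (i % suc k) (j % suc k) eq (m%n<n i (suc k)) (m%n<n j (suc k))

mod-toℕ : ∀ {k} (i : Fin (suc k)) → toℕ i mod suc k ≡ i
mod-toℕ {k} i = Fin.toℕ-injective
  (trans (Fin.toℕ-fromℕ< (m%n<n (toℕ i) (suc k))) (m<n⇒m%n≡m (Fin.toℕ<n i)))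

module Period {m} (b : PeriodicCF m) where
  open PeriodicCF b public

  term-last : term (suc m) ≡ 2 * b₀
  term-last = trans (cong (lookup (bs ∷ʳ 2 * b₀))
    (trans (cong (_mod suc m) (sym (Fin.toℕ-fromℕ m))) (mod-toℕ (maxFin m))))
    (lookup-∷ʳ-last bs (2 * b₀))

  term-lookup : ∀ i → term (suc (toℕ i)) ≡ lookup bs i
  term-lookup i = trans (cong (lookup (bs ∷ʳ 2 * b₀))
    (trans (cong (_mod suc m) (sym (Fin.toℕ-inject₁ i))) (mod-toℕ (inject₁ i))))
    (lookup-∷ʳ-inject₁ bs (2 * b₀) i)

  term-period : ∀ i → term (suc m ℕ.+ suc i) ≡ term (suc i)
  term-period i = cong (lookup (bs ∷ʳ 2 * b₀)) (mod-cong (m ℕ.+ suc i) i (trans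
    (cong (_% suc m) (trans (ℕ.+-suc m i) (ℕ.+-comm (suc m) i))) ([m+n]%n≡m%n i (suc m))))

  -- Every period after the first begins with 2 b₀ instead of b₀. The matrix of 2 b₀ is (1 , b₀ ; 0
  -- , 1) times the matrix of b₀; absorbing this shear into the preceding period lets all periods
  -- act by the same matrix `W`.
  shear : ℕ × ℕ → ℕ × ℕ
  shear (x , y) = x ℕ.+ b₀ * y , y

  W : ℕ × ℕ → ℕ × ℕ
  W v = act term (suc m) (shear v)

  col-period : ∀ n → col term (suc m ℕ.+ n) ≡ W (col term n)
  col-period n = trans (act-+ term (suc m) n (1 , 0)) (cong (act term (suc m)) (shift n))
    where
    eq : ∀ c x y → (2 * c) * x ℕ.+ y ≡ c * x ℕ.+ y ℕ.+ c * x
    eq = ℕ-ring.solve-∀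
    shift : ∀ n → act (λ i → term (suc m ℕ.+ i)) n (1 , 0) ≡ shear (col term n)
    shift zero    = cong (λ n → suc n , 0) (sym (ℕ.*-zeroʳ b₀))
    shift (suc n) = trans
      (cong₂ step (trans (cong (term ∘ suc) (ℕ.+-identityʳ m)) term-last)
        (act-cong term-period n (1 , 0)))
      (cong (_, proj₁ p) (eq b₀ (proj₁ p) (proj₂ p)))
      where p = act (term ∘ suc) n (1 , 0)

  W-linear : ∀ v → W v ≡ apply (W (1 , 0)) (W (0 , 1)) v
  W-linear v@(x , y) = trans (act-linear term (suc m) (shear v)) (trans
    (cong₂ _,_ (eq b₀ x y (proj₁ p) (proj₁ q)) (eq b₀ x y (proj₂ p) (proj₂ q)))
    (cong₂ (λ e f → apply e f v) (sym (act-linear term (suc m) (shear (1 , 0))))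
                                 (sym (act-linear term (suc m) (shear (0 , 1))))))
    where
    p = act term (suc m) (1 , 0)
    q = act term (suc m) (0 , 1)
    eq : ∀ c x y r t → r * (x ℕ.+ c * y) ℕ.+ t * y ≡
         (r * (1 ℕ.+ c * 0) ℕ.+ t * 0) * x ℕ.+ (r * (0 ℕ.+ c * 1) ℕ.+ t * 1) * y
    eq = ℕ-ring.solve-∀

  cross-shear : ∀ v w → cross (shear v) (shear w) ≡ cross v w
  cross-shear (x , y) (z , w) = trans
    (cong₂ (λ i j → (+ x ℤ.+ i) ℤ.* + w ℤ.- (+ z ℤ.+ j) ℤ.* + y) (ℤ.pos-* b₀ y) (ℤ.pos-* b₀ w))
    (eq (+ b₀) (+ x) (+ y) (+ z) (+ w))
    where
    eq : ∀ c x y z w → (x ℤ.+ c ℤ.* y) ℤ.* w ℤ.- (z ℤ.+ c ℤ.* w) ℤ.* y ≡ x ℤ.* w ℤ.- z ℤ.* y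
    eq = ℤ-ring.solve-∀

  cross-W : ∀ v w → cross (W v) (W w) ≡ sign (suc m) ℤ.* cross v w
  cross-W v w = trans (cross-act term (suc m) (shear v) (shear w))
    (cong (sign (suc m) ℤ.*_) (cross-shear v w))

-- The period matrix is a solution of the Pell equation

0≤i*i : ∀ i → 0ℤ ℤ.≤ i ℤ.* i
0≤i*i (+ n)        = subst (0ℤ ℤ.≤_) (ℤ.pos-* n n) (ℤ.+≤+ ℕ.z≤n)
0≤i*i (ℤ.-[1+ n ]) = ℤ.+≤+ ℕ.z≤n

∣i∣≤∣i*j∣ : ∀ i {j} → 0ℤ ℤ.< j → ℤ.∣ i ∣ ≤ ℤ.∣ i ℤ.* j ∣
∣i∣≤∣i*j∣ i {ℤ.+[1+ n ]} (ℤ.+<+ _) = subst (ℤ.∣ i ∣ ≤_) (sym (ℤ.abs-* i ℤ.+[1+ n ])) (ℕ.m≤m*n ℤ.∣ i ∣ (suc n))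

0<i*j : ∀ {i j} → 0ℤ ℤ.< i → 0ℤ ℤ.< j → 0ℤ ℤ.< i ℤ.* j
0<i*j {ℤ.+[1+ _ ]} {ℤ.+[1+ _ ]} (ℤ.+<+ _) (ℤ.+<+ _) = ℤ.+<+ (ℕ.s≤s ℕ.z≤n)

∣sign*i∣ : ∀ n i → ℤ.∣ sign n ℤ.* i ∣ ≡ ℤ.∣ i ∣
∣sign*i∣ n i = trans (ℤ.abs-* (sign n) i) (trans (cong (_* ℤ.∣ i ∣) (∣sign∣≡1 n)) (ℕ.*-identityˡ ℤ.∣ i ∣))

vanish : ∀ c d x y z w → c ℤ.* x ℤ.- d ℤ.* y ≡ 0ℤ → c ℤ.* z ℤ.- d ℤ.* w ≡ 0ℤ →
         ¬ (x ℤ.* w ℤ.- z ℤ.* y ≡ 0ℤ) → c ≡ 0ℤ × d ≡ 0ℤ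
vanish c d x y z w p q det≢0 =
    cancel c (trans (eq₁ c d x y z w) (cong₂ (λ i j → i ℤ.* w ℤ.- j ℤ.* y) p q))
  , cancel d (trans (eq₂ c d x y z w) (cong₂ (λ i j → i ℤ.* z ℤ.- j ℤ.* x) p q))
  where
  eq₁ : ∀ c d x y z w → c ℤ.* (x ℤ.* w ℤ.- z ℤ.* y) ≡ (c ℤ.* x ℤ.- d ℤ.* y) ℤ.* w ℤ.- (c ℤ.* z ℤ.- d ℤ.* w) ℤ.* y
  eq₁ = ℤ-ring.solve-∀
  eq₂ : ∀ c d x y z w → d ℤ.* (x ℤ.* w ℤ.- z ℤ.* y) ≡ (c ℤ.* x ℤ.- d ℤ.* y) ℤ.* z ℤ.- (c ℤ.* z ℤ.- d ℤ.* w) ℤ.* x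
  eq₂ = ℤ-ring.solve-∀
  cancel : ∀ i → i ℤ.* (x ℤ.* w ℤ.- z ℤ.* y) ≡ 0ℤ → i ≡ 0ℤ
  cancel i eq with ℤ.i*j≡0⇒i≡0∨j≡0 i eq
  ... | inj₁ i≡0 = i≡0
  ... | inj₂ det≡0 = contradiction det≡0 det≢0

module _ (D Q : ℕ) .{{_ : NonZero Q}} where

  Alternates : Seq → Set
  Alternates a = ∀ n → 0ℤ ℤ.< sign n ℤ.* form D Q (col a n)

  -- Consecutive columns turn the form into one with outer coefficients of opposite
  -- sign and the same discriminant 4DQ; this bounds its outer coefficients.
  alternates⇒bounded : ∀ {a} → Alternates a → ∀ n → ℤ.∣ form D Q (col a n) ∣ ≤ D * Q
  alternates⇒bounded {a} h n = ℕ.≤-trans (ℕ.≤-trans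
      (ℕ.≤-reflexive (sym (∣sign*i∣ n _)))
      (∣i∣≤∣i*j∣ (sign n ℤ.* G) (h (suc n))))
      (ℤ.drop‿+≤+ (subst₂ ℤ._≤_ (sym (ℤ.0≤i⇒+∣i∣≡i (ℤ.<⇒≤ (0<i*j (h n) (h (suc n)))))) (sym (ℤ.pos-* D Q)) product≤))
    where
    v = col a n
    w = col a (suc n)
    G = form D Q v
    H = form D Q w
    x = + proj₁ v
    y = + proj₂ v
    z = + proj₁ w
    t = + proj₂ w
    -- The polar form at `v` and `w`; `disc` is the invariance of the discriminant up to the squared
    -- determinant. As `H` is a nonzero integer, a bound on the product is one on `G`.
    B = + Q ℤ.* (x ℤ.* z) ℤ.- + D ℤ.* (y ℤ.* t)
    disc : ∀ Q D x y z t → ℤ.- ((Q ℤ.* (x ℤ.* x) ℤ.- D ℤ.* (y ℤ.* y)) ℤ.* (Q ℤ.* (z ℤ.* z) ℤ.- D ℤ.* (t ℤ.* t))) ≡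
      (D ℤ.* Q) ℤ.* ((x ℤ.* t ℤ.- z ℤ.* y) ℤ.* (x ℤ.* t ℤ.- z ℤ.* y))
        ℤ.- (Q ℤ.* (x ℤ.* z) ℤ.- D ℤ.* (y ℤ.* t)) ℤ.* (Q ℤ.* (x ℤ.* z) ℤ.- D ℤ.* (y ℤ.* t))
    disc = ℤ-ring.solve-∀
    regroup : ∀ s g h → s ℤ.* g ℤ.* (ℤ.- s ℤ.* h) ≡ (s ℤ.* s) ℤ.* (ℤ.- (g ℤ.* h))
    regroup = ℤ-ring.solve-∀
    product≤ : sign n ℤ.* G ℤ.* (sign (suc n) ℤ.* H) ℤ.≤ + D ℤ.* + Q
    product≤ = begin
      sign n ℤ.* G ℤ.* (sign (suc n) ℤ.* H)                  ≡⟨ regroup (sign n) G H ⟩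
      (sign n ℤ.* sign n) ℤ.* (ℤ.- (G ℤ.* H))                ≡⟨ cong (ℤ._* (ℤ.- (G ℤ.* H))) (sign*sign n) ⟩
      1ℤ ℤ.* (ℤ.- (G ℤ.* H))                                 ≡⟨ ℤ.*-identityˡ (ℤ.- (G ℤ.* H)) ⟩
      ℤ.- (G ℤ.* H)                                          ≡⟨ disc (+ Q) (+ D) x y z t ⟩
      (+ D ℤ.* + Q) ℤ.* (cross v w ℤ.* cross v w) ℤ.- B ℤ.* B ≡⟨ cong (λ s → (+ D ℤ.* + Q) ℤ.* (s ℤ.* s) ℤ.- B ℤ.* B) (cross-col a n) ⟩
      (+ D ℤ.* + Q) ℤ.* (sign n ℤ.* sign n) ℤ.- B ℤ.* B      ≡⟨ cong (λ s → (+ D ℤ.* + Q) ℤ.* s ℤ.- B ℤ.* B) (sign*sign n) ⟩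
      (+ D ℤ.* + Q) ℤ.* 1ℤ ℤ.- B ℤ.* B                       ≡⟨ cong (ℤ._- B ℤ.* B) (ℤ.*-identityʳ (+ D ℤ.* + Q)) ⟩
      + D ℤ.* + Q ℤ.- B ℤ.* B                                ≤⟨ ℤ.i≤j⇒i-k≤j (B ℤ.* B) {{ℤ.nonNegative (0≤i*i B)}} ℤ.≤-refl ⟩
      + D ℤ.* + Q                                            ∎
      where open ℤ.≤-Reasoning

  -- For large l the integer e l is 0, which makes the fixed points of the matrix
  -- (r , t ; s , u) the roots of the form.
  module Orbit {r s t u : ℕ} (v : ℕ → ℕ × ℕ) (0<s : 0 ℕ.< s)
    (v-suc : ∀ l → v (suc l) ≡ apply (r , s) (t , u) (v l))
    (∣cross-v∣ : ∀ l → ℤ.∣ cross (v l) (v (suc l)) ∣ ≡ s)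
    (pred≤den : ∀ l → l ∸ 1 ≤ proj₂ (v l))
    (bounded : ∀ l → ℤ.∣ form D Q (v l) ∣ ≤ D * Q) where

    private
      c d : ℤ
      c = + Q ℤ.* (+ u ℤ.- + r)
      d = + Q ℤ.* + t ℤ.- + s ℤ.* + D

      -- Subtracting s (Q x² - D y²) from Q times the form of the matrix cancels x²; what remains is
      -- y times this linear form.
      e : ℕ → ℤ
      e l = c ℤ.* + proj₁ (v l) ℤ.- d ℤ.* + proj₂ (v l)

      -- cross (v l) (v (suc l)) is the value of the form s x² + (u - r) x y - t y² at v l.
      y*e : ∀ l → + proj₂ (v l) ℤ.* e l ≡
                  + Q ℤ.* cross (v l) (v (suc l)) ℤ.- + s ℤ.* form D Q (v l)
      y*e l = trans (eq (+ Q) (+ D) (+ r) (+ s) (+ t) (+ u) (+ x) (+ y))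
        (cong (λ z → + Q ℤ.* z ℤ.- + s ℤ.* form D Q (v l))
          (trans (cong₂ (λ i j → + x ℤ.* i ℤ.- j ℤ.* + y) (sym (pos-bilinear s x u y)) (sym (pos-bilinear r x t y)))
                 (cong (cross (v l)) (sym (v-suc l)))))
        where
        x = proj₁ (v l)
        y = proj₂ (v l)
        eq : ∀ Q D r s t u x y →
          y ℤ.* ((Q ℤ.* (u ℤ.- r)) ℤ.* x ℤ.- (Q ℤ.* t ℤ.- s ℤ.* D) ℤ.* y) ≡
          Q ℤ.* (x ℤ.* (s ℤ.* x ℤ.+ u ℤ.* y) ℤ.- (r ℤ.* x ℤ.+ t ℤ.* y) ℤ.* y)
            ℤ.- s ℤ.* (Q ℤ.* (x ℤ.* x) ℤ.- D ℤ.* (y ℤ.* y))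
        eq = ℤ-ring.solve-∀

      K = Q * s ℕ.+ s * (D * Q)

      y*e≤K : ∀ l → proj₂ (v l) * ℤ.∣ e l ∣ ≤ K
      y*e≤K l = begin
        proj₂ (v l) * ℤ.∣ e l ∣                        ≡⟨ ℤ.abs-* (+ proj₂ (v l)) (e l) ⟨
        ℤ.∣ + proj₂ (v l) ℤ.* e l ∣                    ≡⟨ cong ℤ.∣_∣ (y*e l) ⟩
        ℤ.∣ + Q ℤ.* cross (v l) (v (suc l)) ℤ.- + s ℤ.* form D Q (v l) ∣
          ≤⟨ ℤ.∣i-j∣≤∣i∣+∣j∣ (+ Q ℤ.* cross (v l) (v (suc l))) (+ s ℤ.* form D Q (v l)) ⟩
        ℤ.∣ + Q ℤ.* cross (v l) (v (suc l)) ∣ ℕ.+ ℤ.∣ + s ℤ.* form D Q (v l) ∣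
          ≡⟨ cong₂ ℕ._+_ (trans (ℤ.abs-* (+ Q) (cross (v l) (v (suc l)))) (cong (Q *_) (∣cross-v∣ l)))
                         (ℤ.abs-* (+ s) (form D Q (v l))) ⟩
        Q * s ℕ.+ s * ℤ.∣ form D Q (v l) ∣
          ≤⟨ ℕ.+-monoʳ-≤ (Q * s) (ℕ.*-monoʳ-≤ s (bounded l)) ⟩
        K                                              ∎
        where open ℕ.≤-Reasoning

      e≡0 : ∀ l → suc K ℕ.< l → e l ≡ 0ℤ
      e≡0 l K<l = ℤ.∣i∣≡0⇒i≡0 (ℕ.n<1⇒n≡0 (ℕ.*-cancelˡ-< (suc K) ℤ.∣ e l ∣ 1 (begin-strict
        suc K * ℤ.∣ e l ∣        ≤⟨ ℕ.*-monoˡ-≤ ℤ.∣ e l ∣ (ℕ.≤-trans (ℕ.∸-monoˡ-≤ 1 K<l) (pred≤den l)) ⟩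
        proj₂ (v l) * ℤ.∣ e l ∣  ≤⟨ y*e≤K l ⟩
        K                        <⟨ ℕ.n<1+n K ⟩
        suc K                    ≡⟨ ℕ.*-identityʳ (suc K) ⟨
        suc K * 1                ∎)))
        where open ℕ.≤-Reasoning

      -- The linear form `e` vanishes at two consecutive orbit vectors, which are independent since
      -- their cross product has absolute value s > 0.
      c≡0×d≡0 : c ≡ 0ℤ × d ≡ 0ℤ
      c≡0×d≡0 = vanish c d (+ proj₁ (v L)) (+ proj₂ (v L)) (+ proj₁ (v (suc L))) (+ proj₂ (v (suc L)))
        (e≡0 L ℕ.≤-refl) (e≡0 (suc L) (ℕ.n≤1+n L))
        λ eq → ℕ.<⇒≢ 0<s (trans (sym (cong ℤ.∣_∣ eq)) (∣cross-v∣ L))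
        where L = suc (suc K)

    u≡r : u ≡ r
    u≡r = case (ℤ.i*j≡0⇒i≡0∨j≡0 (+ Q) (proj₁ c≡0×d≡0))
      where
      case : + Q ≡ 0ℤ ⊎ + u ℤ.- + r ≡ 0ℤ → u ≡ r
      case (inj₁ eq) = contradiction (ℤ.+-injective eq) (ℕ.≢-nonZero⁻¹ Q)
      case (inj₂ eq) = ℤ.+-injective (ℤ.i-j≡0⇒i≡j (+ u) (+ r) eq)

    Qt≡sD : Q * t ≡ s * D
    Qt≡sD = ℤ.+-injective (trans (ℤ.pos-* Q t)
      (trans (ℤ.i-j≡0⇒i≡j (+ Q ℤ.* + t) (+ s ℤ.* + D) (proj₂ c≡0×d≡0)) (sym (ℤ.pos-* s D))))

  pell : ℕ → ℕ → ℕ × ℕ → ℕ × ℕ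
  pell x y = apply (x , Q * y) (D * y , x)

  module _ {m} (b : PeriodicCF m) (h : Alternates (PeriodicCF.term b)) where
    open Period b

    private
      r s t u : ℕ
      r = proj₁ (W (1 , 0))
      s = proj₂ (W (1 , 0))
      t = proj₁ (W (0 , 1))
      u = proj₂ (W (0 , 1))

      v : ℕ → ℕ × ℕ
      v l = col term (l * suc m)

      v-suc : ∀ l → v (suc l) ≡ W (v l)
      v-suc l = col-period (l * suc m)

      v-suc′ : ∀ l → v (suc l) ≡ apply (r , s) (t , u) (v l)
      v-suc′ l = trans (v-suc l) (W-linear (v l))

      -- `W` multiplies `cross` by ±1, so the absolute value remains that for (1 , 0) and (r , s).
      ∣cross-v∣ : ∀ l → ℤ.∣ cross (v l) (v (suc l)) ∣ ≡ s
      ∣cross-v∣ zero    = cong ℤ.∣_∣ (trans (cong (cross (1 , 0)) (v-suc 0)) (eq (+ r) (+ s)))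
        where
        eq : ∀ r s → 1ℤ ℤ.* s ℤ.- r ℤ.* 0ℤ ≡ s
        eq = ℤ-ring.solve-∀
      ∣cross-v∣ (suc l) = begin
        ℤ.∣ cross (v (suc l)) (v (2 ℕ.+ l)) ∣              ≡⟨ cong₂ (λ p q → ℤ.∣ cross p q ∣) (v-suc l) (v-suc (suc l)) ⟩
        ℤ.∣ cross (W (v l)) (W (v (suc l))) ∣              ≡⟨ cong ℤ.∣_∣ (cross-W (v l) (v (suc l))) ⟩
        ℤ.∣ sign (suc m) ℤ.* cross (v l) (v (suc l)) ∣     ≡⟨ ∣sign*i∣ (suc m) _ ⟩
        ℤ.∣ cross (v l) (v (suc l)) ∣                      ≡⟨ ∣cross-v∣ l ⟩
        s                                                  ∎
        where open ≡-Reasoning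

      pred≤den : ∀ n → n ∸ 1 ≤ proj₂ (col term n)
      pred≤den zero    = ℕ.z≤n
      pred≤den (suc n) = n≤num (term ∘ suc) (term≢0 ∘ suc) n

      0<s : 0 ℕ.< s
      0<s = subst (λ z → 0 ℕ.< proj₂ z) (trans (cong (col term) (sym (ℕ.+-identityʳ (suc m)))) (col-period 0))
              (0<num (term ∘ suc) (term≢0 ∘ suc) m)

      open Orbit {r} {s} {t} {u} v 0<s v-suc′ ∣cross-v∣
        (λ l → ℕ.≤-trans (ℕ.∸-monoˡ-≤ 1 (ℕ.m≤m*n l (suc m))) (pred≤den (l * suc m)))
        (λ l → alternates⇒bounded {term} h (l * suc m))

    -- The orbit yields u = r and Q t = s D. As Q is prime to D it divides s; the quotient is y, and
    -- then t = D y.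
    alternates⇒pell : gcd D Q ≡ 1 → ∃[ x ] ∃[ y ] 0 ℕ.< y × (∀ v → W v ≡ pell x y v)
    alternates⇒pell gcd≡1 = quotient (Coprimality.coprime-divisor {Q} {D} {s}
        (Coprimality.sym (Coprimality.gcd≡1⇒coprime gcd≡1))
        (divides t (trans (ℕ.*-comm D s) (trans (sym Qt≡sD) (ℕ.*-comm Q t)))))
      where
      quotient : Q ∣ s → ∃[ x ] ∃[ y ] 0 ℕ.< y × (∀ v → W v ≡ pell x y v)
      quotient (divides y s≡yQ) = r , y , 0<y , λ v → trans (W-linear v)
          (cong₂ (λ p q → apply p q v) (cong (r ,_) s≡Qy) (cong₂ _,_ t≡Dy u≡r))
        where
        s≡Qy : s ≡ Q * y
        s≡Qy = trans s≡yQ (ℕ.*-comm y Q)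
        t≡Dy : t ≡ D * y
        t≡Dy = ℕ.*-cancelˡ-≡ t (D * y) Q (trans Qt≡sD (trans (cong (_* D) s≡Qy) (eq Q y D)))
          where
          eq : ∀ Q y D → Q * y * D ≡ Q * (D * y)
          eq = ℕ-ring.solve-∀
        0<y : 0 ℕ.< y
        0<y = ℕ.n≢0⇒n>0 λ y≡0 → ℕ.<⇒≢ 0<s (sym (trans s≡yQ (cong (_* Q) y≡0)))

-- Factoring the matrix of a Pell solution

actVec : ∀ {k} → Vec ℕ k → ℕ × ℕ → ℕ × ℕ
actVec []       v = v
actVec (c ∷ cs) v = step c (actVec cs v)

Factorization : (c₁ c₂ : ℕ × ℕ) → Set
Factorization c₁ c₂ = ∃[ k ] ∃[ cs ] (∀ i → NonZero (lookup {n = k} cs i)) ×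
                      (∀ v → actVec cs v ≡ apply c₁ c₂ v)

Unimodular : ℕ → ℕ → ℕ → ℕ → Set
Unimodular p p′ q q′ = p * q′ ≡ 1 ℕ.+ p′ * q ⊎ 1 ℕ.+ p * q′ ≡ p′ * q

prepend : ∀ {e q q′ r z} → .(NonZero e) → Factorization (q , r) (q′ , z) →
          Factorization (r ℕ.+ e * q , q) (z ℕ.+ e * q′ , q′)
prepend {e} {q} {q′} {r} {z} e≢0 (k , cs , cs≢0 , act≡) =
    suc k , e ∷ cs , (λ { fzero → ℕ.≢-nonZero (ℕ.≢-nonZero⁻¹ e {{e≢0}}) ; (fsuc i) → cs≢0 i }) ,
    λ v → trans (cong (step e) (act≡ v)) (cong (_, q * proj₁ v ℕ.+ q′ * proj₂ v) (eq e q q′ r z (proj₁ v) (proj₂ v)))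
  where
  eq : ∀ e q q′ r z x y → e * (q * x ℕ.+ q′ * y) ℕ.+ (r * x ℕ.+ z * y) ≡ (r ℕ.+ e * q) * x ℕ.+ (z ℕ.+ e * q′) * y
  eq = ℕ-ring.solve-∀

1≢q*n : ∀ {q} n → 2 ≤ q → ¬ (1 ≡ q * n)
1≢q*n {q} n 2≤q eq = ℕ.<⇒≢ 2≤q (sym (ℕ.m*n≡1⇒m≡1 q n (sym eq)))

module _ {q q′ r z : ℕ} (r<q : r ℕ.< q) (q′≤q : q′ ≤ q) (2≤q : 2 ≤ q) (0<q′ : 0 ℕ.< q′)
         (det : Unimodular q q′ r z) where

  private
    instance
      q≢0 : NonZero q
      q≢0 = ℕ.>-nonZero (ℕ.≤-trans (ℕ.s≤s ℕ.z≤n) 2≤q)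

  -- These are invariants of the recursion in `factor`: the next matrix (q , q′ ; r , z) again
  -- decreases weakly along rows and columns. A determinant of ±1 is too small to violate them when
  -- q ≥ 2.
  remainder≤ : z ≤ r × z ≤ q′
  remainder≤ = go det
    where
    open ℕ.≤-Reasoning
    go : Unimodular q q′ r z → z ≤ r × z ≤ q′
    go (inj₁ qz≡1+q′r) = ℕ.≤-pred (ℕ.*-cancelˡ-< q z (suc r) (begin-strict
          q * z          ≡⟨ qz≡1+q′r ⟩
          1 ℕ.+ q′ * r   ≤⟨ ℕ.+-monoʳ-≤ 1 (ℕ.*-monoˡ-≤ r q′≤q) ⟩
          1 ℕ.+ q * r    <⟨ ℕ.+-monoˡ-< (q * r) 2≤q ⟩
          q ℕ.+ q * r    ≡⟨ ℕ.*-suc q r ⟨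
          q * suc r      ∎))
      , ℕ.*-cancelˡ-≤ q (begin
          q * z          ≡⟨ qz≡1+q′r ⟩
          1 ℕ.+ q′ * r   ≤⟨ ℕ.+-monoˡ-≤ (q′ * r) 0<q′ ⟩
          q′ ℕ.+ q′ * r  ≡⟨ ℕ.*-suc q′ r ⟨
          q′ * suc r     ≤⟨ ℕ.*-monoʳ-≤ q′ r<q ⟩
          q′ * q         ≡⟨ ℕ.*-comm q′ q ⟩
          q * q′         ∎)
    go (inj₂ 1+qz≡q′r) = ℕ.<⇒≤ (ℕ.*-cancelˡ-< q z r (begin-strict
          q * z          <⟨ ℕ.n<1+n (q * z) ⟩
          1 ℕ.+ q * z    ≡⟨ 1+qz≡q′r ⟩
          q′ * r         ≤⟨ ℕ.*-monoˡ-≤ r q′≤q ⟩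
          q * r          ∎))
      , ℕ.<⇒≤ (ℕ.*-cancelˡ-< q z q′ (begin-strict
          q * z          <⟨ ℕ.n<1+n (q * z) ⟩
          1 ℕ.+ q * z    ≡⟨ 1+qz≡q′r ⟩
          q′ * r         ≤⟨ ℕ.*-monoʳ-≤ q′ (ℕ.<⇒≤ r<q) ⟩
          q′ * q         ≡⟨ ℕ.*-comm q′ q ⟩
          q * q′         ∎))

  0<remainder : 0 ℕ.< r
  0<remainder = ℕ.n≢0⇒n>0 (go det)
    where
    go : Unimodular q q′ r z → ¬ (r ≡ 0)
    go (inj₁ eq) refl = 1≢q*n z 2≤q (sym (trans eq (cong suc (ℕ.*-zeroʳ q′))))
    go (inj₂ eq) refl = ℕ.1+n≢0 (trans eq (ℕ.*-zeroʳ q′))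

-- The quotient found from the first column also fits the second: if e q′ exceeded p′, then p q′ -
-- p′ q = r q′ + q (e q′ - p′) would be at least q ≥ 2.
reduce : ∀ {e q q′ r p′} → 2 ≤ q → Unimodular (r ℕ.+ e * q) p′ q q′ →
         ∃[ z ] p′ ≡ z ℕ.+ e * q′ × Unimodular q q′ r z
reduce {e} {q} {q′} {r} {p′} 2≤q det =
    p′ ∸ e * q′ , sym (ℕ.m∸n+n≡m eq′≤p′) ,
    go (p′ ∸ e * q′) (subst (λ w → Unimodular (r ℕ.+ e * q) w q q′) (sym (ℕ.m∸n+n≡m eq′≤p′)) det)
  where
  instance
    q≢0 : NonZero q
    q≢0 = ℕ.>-nonZero (ℕ.≤-trans (ℕ.s≤s ℕ.z≤n) 2≤q)
  open ℕ.≤-Reasoning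
  expand : ∀ e q q′ r → (r ℕ.+ e * q) * q′ ≡ r * q′ ℕ.+ q * (e * q′)
  expand = ℕ-ring.solve-∀

  bound : Unimodular (r ℕ.+ e * q) p′ q q′ → q * (e * q′) ≤ q * p′
  bound (inj₂ eq) = begin
    q * (e * q′)                 ≤⟨ ℕ.m≤n+m _ (suc (r * q′)) ⟩
    1 ℕ.+ (r * q′ ℕ.+ q * (e * q′)) ≡⟨ cong suc (expand e q q′ r) ⟨
    1 ℕ.+ (r ℕ.+ e * q) * q′     ≡⟨ eq ⟩
    p′ * q                       ≡⟨ ℕ.*-comm p′ q ⟩
    q * p′                       ∎
  bound (inj₁ eq) = positive (r * q′) (trans (sym (expand e q q′ r)) (trans eq (cong suc (ℕ.*-comm p′ q))))
    where
    positive : ∀ n → n ℕ.+ q * (e * q′) ≡ 1 ℕ.+ q * p′ → q * (e * q′) ≤ q * p′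
    positive zero    eq = contradiction
      (trans (sym (ℕ.m+n∸n≡m 1 (q * p′))) (trans (cong (_∸ q * p′) (sym eq)) (sym (ℕ.*-distribˡ-∸ q (e * q′) p′))))
      (1≢q*n (e * q′ ∸ p′) 2≤q)
    positive (suc n) eq = ℕ.≤-trans (ℕ.m≤n+m _ n) (ℕ.≤-reflexive (ℕ.suc-injective eq))

  eq′≤p′ : e * q′ ≤ p′
  eq′≤p′ = ℕ.*-cancelˡ-≤ q (bound det)

  cancel₁ : ∀ e q q′ r → (r ℕ.+ e * q) * q′ ≡ e * q * q′ ℕ.+ q′ * r
  cancel₁ = ℕ-ring.solve-∀
  cancel₂ : ∀ e q q′ z → (z ℕ.+ e * q′) * q ≡ e * q * q′ ℕ.+ q * z
  cancel₂ = ℕ-ring.solve-∀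

  go : ∀ z → Unimodular (r ℕ.+ e * q) (z ℕ.+ e * q′) q q′ → Unimodular q q′ r z
  go z (inj₁ eq) = inj₂ (sym (ℕ.+-cancelˡ-≡ (e * q * q′) _ _
    (trans (sym (cancel₁ e q q′ r)) (trans eq (trans (cong suc (cancel₂ e q q′ z)) (sym (ℕ.+-suc (e * q * q′) (q * z))))))))
  go z (inj₂ eq) = inj₁ (sym (ℕ.+-cancelˡ-≡ (e * q * q′) _ _
    (trans (ℕ.+-suc (e * q * q′) (q′ * r)) (trans (cong suc (sym (cancel₁ e q q′ r))) (trans eq (cancel₂ e q q′ z))))))

-- The Euclidean algorithm for the first column, with n bounding the number of steps.
factor : ∀ n {p p′ q q′} → q ≤ n → 0 ℕ.< q → p′ ≤ p → q′ ≤ q → q ≤ p → q′ ≤ p′ →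
         Unimodular p p′ q q′ → Factorization (p , q) (p′ , q′)
factor n {p} {p′} {suc zero} {zero} _ _ _ _ 1≤p _ (inj₁ eq) =
  contradiction (trans (sym eq) (ℕ.*-zeroʳ p)) ℕ.1+n≢0
factor n {p} {p′} {suc zero} {zero} _ _ _ _ 1≤p _ (inj₂ eq) =
  1 , p ∷ [] , (λ { fzero → ℕ.>-nonZero 1≤p }) ,
  λ (x , y) → cong₂ _,_
    (cong (p * x ℕ.+_) (sym (trans (cong (_* y) p′≡1) (ℕ.*-identityˡ y))))
    (sym (trans (ℕ.+-identityʳ (1 * x)) (ℕ.*-identityˡ x)))
  where
  p′≡1 : p′ ≡ 1
  p′≡1 = trans (sym (ℕ.*-identityʳ p′)) (trans (sym eq) (cong suc (ℕ.*-zeroʳ p)))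
-- Here the last quotient p is split into p - 1 = p′ and 1. The two endings give lengths of
-- different parity, and the sign of the determinant selects between them.
factor n {p} {p′} {suc zero} {suc zero} _ _ _ _ _ 1≤p′ (inj₁ eq) =
  2 , p′ ∷ 1 ∷ [] , (λ { fzero → ℕ.>-nonZero 1≤p′ ; (fsuc fzero) → _ }) ,
  λ (x , y) → cong₂ _,_
    (trans (sum p′ x y) (cong (λ c → c * x ℕ.+ p′ * y) (sym p≡1+p′)))
    (cong (1 * x ℕ.+_) (sym (ℕ.*-identityˡ y)))
  where
  p≡1+p′ : p ≡ 1 ℕ.+ p′
  p≡1+p′ = trans (sym (ℕ.*-identityʳ p)) (trans eq (cong suc (ℕ.*-identityʳ p′)))
  sum : ∀ p x y → p * (1 * x ℕ.+ y) ℕ.+ x ≡ (1 ℕ.+ p) * x ℕ.+ p * y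
  sum = ℕ-ring.solve-∀
factor n {p} {p′} {suc zero} {suc zero} _ _ p′≤p _ _ _ (inj₂ eq) =
  contradiction p′≤p (ℕ.<⇒≱ (ℕ.≤-reflexive
    (trans (cong suc (sym (ℕ.*-identityʳ p))) (trans eq (ℕ.*-identityʳ p′)))))
factor n {q = suc zero} {suc (suc _)} _ _ _ (ℕ.s≤s ())
factor (suc n) {p} {p′} {q@(suc (suc _))} {q′} (ℕ.s≤s q≤n) _ _ q′≤q q≤p _ det =
  subst₂ (λ a b → Factorization (a , q) (b , q′)) (sym p≡) (sym p′≡)
    (prepend {e} {q} {q′} {r} {z} (ℕ.>-nonZero (m≥n⇒m/n>0 q≤p))
      (factor n {q} {q′} {r} {z} (ℕ.≤-trans (ℕ.≤-pred r<q) q≤n) (0<remainder {q} {q′} {r} {z} r<q q′≤q 2≤q 0<q′ det′) q′≤q (proj₁ z≤) (ℕ.<⇒≤ r<q) (proj₂ z≤) det′))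
  where
  e = p ℕ./ q
  r = p % q
  r<q = m%n<n p q
  2≤q : 2 ≤ q
  2≤q = ℕ.s≤s (ℕ.s≤s ℕ.z≤n)
  p≡ : p ≡ r ℕ.+ e * q
  p≡ = m≡m%n+[m/n]*n p q
  0<q′ : 0 ℕ.< q′
  0<q′ = ℕ.n≢0⇒n>0 (nonzero det)
    where
    nonzero : Unimodular p p′ q q′ → ¬ (q′ ≡ 0)
    nonzero (inj₁ eq) refl = ℕ.1+n≢0 (trans (sym eq) (ℕ.*-zeroʳ p))
    nonzero (inj₂ eq) refl = 1≢q*n p′ 2≤q (trans (cong suc (sym (ℕ.*-zeroʳ p))) (trans eq (ℕ.*-comm p′ q)))
  reduced = reduce {e} {q} {q′} {r} {p′} 2≤q (subst (λ a → Unimodular a p′ q q′) p≡ det)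
  z = proj₁ reduced
  p′≡ = proj₁ (proj₂ reduced)
  det′ = proj₂ (proj₂ reduced)
  z≤ = remainder≤ {q} {q′} {r} {z} r<q q′≤q 2≤q 0<q′ det′

m²≤n²⇒m≤n : ∀ {m n} → m * m ≤ n * n → m ≤ n
m²≤n²⇒m≤n m²≤n² = ℕ.≮⇒≥ λ n<m → ℕ.<⇒≱ (ℕ.*-mono-< n<m n<m) m²≤n²

unimodular-≤ : ∀ {p p′ q q′} → Unimodular p p′ q q′ →
               p * q′ ≤ 1 ℕ.+ p′ * q × p′ * q ≤ 1 ℕ.+ p * q′
unimodular-≤ (inj₁ eq) = ℕ.≤-reflexive eq , ℕ.≤-trans (ℕ.n≤1+n _) (ℕ.≤-trans (ℕ.≤-reflexive (sym eq)) (ℕ.n≤1+n _))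
unimodular-≤ (inj₂ eq) = ℕ.≤-trans (ℕ.n≤1+n _) (ℕ.≤-trans (ℕ.≤-reflexive eq) (ℕ.n≤1+n _)) , ℕ.≤-reflexive (sym eq)

module _ {D Q A x y : ℕ} .{{_ : NonZero Q}} (lo : Q * (A * A) ℕ.< D) (hi : D ℕ.< Q * (suc A * suc A))
         (0<y : 0 ℕ.< y) (sol : Unimodular x (D * y) (Q * y) x) where

  private
    -- Removing the factor of `A` on the left and the shear by `A` on the right from (x , D y ; Q y
    -- , x) leaves the symmetric matrix (α , β ; β , δ). What has to be shown is that its entries
    -- are natural numbers ordered as `factor` requires.
    α = Q * y

    instance
      α≢0 : NonZero α
      α≢0 = ℕ.>-nonZero (ℕ.*-mono-≤ (ℕ.>-nonZero⁻¹ Q) 0<y)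

    0<yα : 1 ≤ y * α
    0<yα = ℕ.*-mono-≤ 0<y (ℕ.>-nonZero⁻¹ α)

    square : ∀ Q y c → (c * (Q * y)) * (c * (Q * y)) ≡ Q * (c * c) * (y * (Q * y))
    square = ℕ-ring.solve-∀

    -- The Pell equation compares squares only up to 1; strictness of `lo` makes up for this,
    -- because y α ≥ 1.
    Aα≤x : A * α ≤ x
    Aα≤x = m²≤n²⇒m≤n (ℕ.≤-pred (begin
      1 ℕ.+ (A * α) * (A * α)              ≡⟨ cong suc (square Q y A) ⟩
      1 ℕ.+ Q * (A * A) * (y * α)          ≤⟨ ℕ.+-monoˡ-≤ _ 0<yα ⟩
      suc (Q * (A * A)) * (y * α)          ≤⟨ ℕ.*-monoˡ-≤ (y * α) lo ⟩
      D * (y * α)                          ≡⟨ ℕ.*-assoc D y α ⟨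
      D * y * α                            ≤⟨ proj₂ (unimodular-≤ {x} {D * y} {α} {x} sol) ⟩
      1 ℕ.+ x * x                          ∎))
      where open ℕ.≤-Reasoning

    x≤[1+A]α : x ≤ suc A * α
    x≤[1+A]α = m²≤n²⇒m≤n (begin
      x * x                                ≤⟨ proj₁ (unimodular-≤ {x} {D * y} {α} {x} sol) ⟩
      1 ℕ.+ D * y * α                      ≡⟨ cong suc (ℕ.*-assoc D y α) ⟩
      1 ℕ.+ D * (y * α)                    ≤⟨ ℕ.+-monoˡ-≤ _ 0<yα ⟩
      suc D * (y * α)                      ≤⟨ ℕ.*-monoˡ-≤ (y * α) hi ⟩
      Q * (suc A * suc A) * (y * α)        ≡⟨ square Q y (suc A) ⟨
      (suc A * α) * (suc A * α)            ∎)
      where open ℕ.≤-Reasoning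

    β = x ∸ A * α

    x≡ : x ≡ β ℕ.+ A * α
    x≡ = sym (ℕ.m∸n+n≡m Aα≤x)

    β≤α : β ≤ α
    β≤α = ℕ.≤-trans (ℕ.∸-monoˡ-≤ (A * α) x≤[1+A]α) (ℕ.≤-reflexive (ℕ.m+n∸n≡m α (A * α)))

    γ = 2 * A * β ℕ.+ A * A * α

    x²≡ : x * x ≡ β * β ℕ.+ α * γ
    x²≡ = trans (cong (λ z → z * z) x≡) (eq A α β)
      where
      eq : ∀ A α β → (β ℕ.+ A * α) * (β ℕ.+ A * α) ≡ β * β ℕ.+ α * (2 * A * β ℕ.+ A * A * α)
      eq = ℕ-ring.solve-∀

    γ≤Dy : γ ≤ D * y
    γ≤Dy = case (ℕ.m≤n⇒m<n∨m≡n {0} {β} ℕ.z≤n)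
      where
      open ℕ.≤-Reasoning
      eq : ∀ A Q y → 2 * A * 0 ℕ.+ A * A * (Q * y) ≡ Q * (A * A) * y
      eq = ℕ-ring.solve-∀
      case : 0 ℕ.< β ⊎ 0 ≡ β → γ ≤ D * y
      case (inj₁ 0<β) = ℕ.*-cancelˡ-≤ α (ℕ.≤-pred (begin
        1 ℕ.+ α * γ                        ≤⟨ ℕ.+-monoˡ-≤ (α * γ) (ℕ.*-mono-≤ 0<β 0<β) ⟩
        β * β ℕ.+ α * γ                    ≡⟨ x²≡ ⟨
        x * x                              ≤⟨ proj₁ (unimodular-≤ {x} {D * y} {α} {x} sol) ⟩
        1 ℕ.+ D * y * α                    ≡⟨ cong suc (ℕ.*-comm (D * y) α) ⟩
        1 ℕ.+ α * (D * y)                  ∎))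
      case (inj₂ 0≡β) = begin
        γ                                  ≡⟨ cong (λ b → 2 * A * b ℕ.+ A * A * α) (sym 0≡β) ⟩
        2 * A * 0 ℕ.+ A * A * α            ≡⟨ eq A Q y ⟩
        Q * (A * A) * y                    ≤⟨ ℕ.*-monoˡ-≤ y (ℕ.<⇒≤ lo) ⟩
        D * y                              ∎

    δ = D * y ∸ γ

    Dy≡ : D * y ≡ δ ℕ.+ γ
    Dy≡ = sym (ℕ.m∸n+n≡m γ≤Dy)

    Dyα≡ : D * y * α ≡ α * δ ℕ.+ α * γ
    Dyα≡ = trans (ℕ.*-comm (D * y) α) (trans (cong (α *_) Dy≡) (ℕ.*-distribˡ-+ α δ γ))

    det : Unimodular α β β δ
    det = go sol
      where
      go : Unimodular x (D * y) α x → Unimodular α β β δ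
      go (inj₁ eq) = inj₂ (sym (ℕ.+-cancelʳ-≡ (α * γ) _ _ (trans (sym x²≡) (trans eq (cong suc Dyα≡)))))
      go (inj₂ eq) = inj₁ (sym (ℕ.+-cancelʳ-≡ (α * γ) _ _ (trans (cong suc (sym x²≡)) (trans eq Dyα≡))))

    -- For β < α the determinant suffices. For β = α it does not, since α = β = 1 would allow δ = 2;
    -- there `hi` decides.
    δ≤β : 0 ℕ.< β → δ ≤ β
    δ≤β 0<β = case (ℕ.m≤n⇒m<n∨m≡n β≤α)
      where
      open ℕ.≤-Reasoning
      eq₁ : ∀ A Q y → Q * (suc A * suc A) * y ≡ (Q * y) ℕ.+ (2 * A * (Q * y) ℕ.+ A * A * (Q * y))
      eq₁ = ℕ-ring.solve-∀
      eq₂ : ∀ δ γ y → δ ℕ.+ y ℕ.+ γ ≡ y ℕ.+ (δ ℕ.+ γ)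
      eq₂ = ℕ-ring.solve-∀
      case : β ℕ.< α ⊎ β ≡ α → δ ≤ β
      case (inj₁ β<α) = ℕ.*-cancelˡ-≤ α (begin
        α * δ          ≤⟨ proj₁ (unimodular-≤ {α} {β} {β} {δ} det) ⟩
        1 ℕ.+ β * β    ≤⟨ ℕ.+-monoˡ-≤ (β * β) 0<β ⟩
        suc β * β      ≤⟨ ℕ.*-monoˡ-≤ β β<α ⟩
        α * β          ∎)
      case (inj₂ β≡α) = ℕ.≤-trans (ℕ.m≤m+n δ y) (ℕ.≤-trans (ℕ.+-cancelʳ-≤ γ (δ ℕ.+ y) α (begin
        δ ℕ.+ y ℕ.+ γ              ≡⟨ eq₂ δ γ y ⟩
        y ℕ.+ (δ ℕ.+ γ)            ≡⟨ cong (y ℕ.+_) Dy≡ ⟨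
        suc D * y                  ≤⟨ ℕ.*-monoˡ-≤ y hi ⟩
        Q * (suc A * suc A) * y    ≡⟨ eq₁ A Q y ⟩
        α ℕ.+ (2 * A * α ℕ.+ A * A * α) ≡⟨ cong (λ b → α ℕ.+ (2 * A * b ℕ.+ A * A * α)) β≡α ⟨
        α ℕ.+ γ                    ∎)) (ℕ.≤-reflexive (sym β≡α)))

    core : Factorization (α , β) (β , δ)
    core = case (ℕ.m≤n⇒m<n∨m≡n {0} {β} ℕ.z≤n)
      where
      -- With β = 0 the determinant forces α = δ = 1, so the block is empty and the period is the
      -- single term 2 A.
      identity : ∀ {β} → 0 ≡ β → Unimodular α β β δ → Factorization (α , β) (β , δ)
      identity refl (inj₁ αδ≡1) = 0 , [] , (λ ()) ,
        λ v → trans (act-linear (λ _ → 0) 0 v)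
          (cong₂ (λ a d → apply (a , 0) (0 , d) v) (sym (ℕ.m*n≡1⇒m≡1 α δ αδ≡1)) (sym (ℕ.m*n≡1⇒n≡1 α δ αδ≡1)))
      case : 0 ℕ.< β ⊎ 0 ≡ β → Factorization (α , β) (β , δ)
      case (inj₁ 0<β) = factor β {α} {β} {β} {δ} ℕ.≤-refl 0<β β≤α (δ≤β 0<β) β≤α (δ≤β 0<β) det
      case (inj₂ 0≡β) = identity 0≡β det

  pell-factor : ∃[ k ] ∃[ cs ] (∀ i → NonZero (lookup {n = k} cs i)) ×
    (∀ v → step A (actVec cs (proj₁ v ℕ.+ A * proj₂ v , proj₂ v)) ≡ apply (x , Q * y) (D * y , x) v)
  pell-factor = go core
    where
    eq₁ : ∀ A α β δ X Y → A * (α * (X ℕ.+ A * Y) ℕ.+ β * Y) ℕ.+ (β * (X ℕ.+ A * Y) ℕ.+ δ * Y) ≡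
          (β ℕ.+ A * α) * X ℕ.+ (δ ℕ.+ (2 * A * β ℕ.+ A * A * α)) * Y
    eq₁ = ℕ-ring.solve-∀
    eq₂ : ∀ A α β X Y → α * (X ℕ.+ A * Y) ℕ.+ β * Y ≡ α * X ℕ.+ (β ℕ.+ A * α) * Y
    eq₂ = ℕ-ring.solve-∀
    go : Factorization (α , β) (β , δ) → ∃[ k ] ∃[ cs ] (∀ i → NonZero (lookup {n = k} cs i)) ×
      (∀ v → step A (actVec cs (proj₁ v ℕ.+ A * proj₂ v , proj₂ v)) ≡ apply (x , Q * y) (D * y , x) v)
    go (k , cs , cs≢0 , act≡) = k , cs , cs≢0 , λ (X , Y) → trans (cong (step A) (act≡ (X ℕ.+ A * Y , Y)))
      (trans (cong₂ _,_ (eq₁ A α β δ X Y) (eq₂ A α β X Y))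
             (cong₂ (λ a b → a * X ℕ.+ b * Y , α * X ℕ.+ a * Y) (sym x≡) (sym Dy≡)))

-- The minimal period is the smallest Pell solution

act-lookup : ∀ {k} a (cs : Vec ℕ k) → (∀ i → a (toℕ i) ≡ lookup cs i) → ∀ v → act a k v ≡ actVec cs v
act-lookup a []       a≡ v = refl
act-lookup a (c ∷ cs) a≡ v = cong₂ step (a≡ fzero) (act-lookup (a ∘ suc) cs (a≡ ∘ fsuc) v)

inv-cong : ∀ {x y} (x⁺ : Positive x) (y⁺ : Positive y) → x ≡ y → inv x {{x⁺}} ≡ inv y {{y⁺}}
inv-cong x⁺ y⁺ refl = refl

cf-cong : ∀ {a a′} (a⁺ : Pos a) (a′⁺ : Pos a′) → (∀ i → a i ≡ a′ i) → ∀ k → cf a a⁺ k ≡ cf a′ a′⁺ k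
cf-cong a⁺ a′⁺ a≗a′ zero    = cong (λ n → + n / 1) (a≗a′ 0)
cf-cong {a} {a′} a⁺ a′⁺ a≗a′ (suc k) = cong₂ (λ n z → + n / 1 ℚ.+ z) (a≗a′ 0)
  (inv-cong (cf-pos (a ∘ suc) (a⁺ ∘ suc) k) (cf-pos (a′ ∘ suc) (a′⁺ ∘ suc) k)
    (cf-cong (a⁺ ∘ suc) (a′⁺ ∘ suc) (a≗a′ ∘ suc) k))

sign-+ : ∀ m n → sign (m ℕ.+ n) ≡ sign m ℤ.* sign n
sign-+ zero    n = sym (ℤ.*-identityˡ (sign n))
sign-+ (suc m) n = trans (cong ℤ.-_ (sign-+ m n)) (ℤ.neg-distribˡ-* (sign m) (sign n))

sign-cases : ∀ n → sign n ≡ 1ℤ ⊎ sign n ≡ ℤ.- 1ℤ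
sign-cases zero = inj₁ refl
sign-cases (suc n) = case (sign-cases n)
  where
  case : sign n ≡ 1ℤ ⊎ sign n ≡ ℤ.- 1ℤ → ℤ.- sign n ≡ 1ℤ ⊎ ℤ.- sign n ≡ ℤ.- 1ℤ
  case (inj₁ eq) = inj₂ (cong ℤ.-_ eq)
  case (inj₂ eq) = inj₁ (cong ℤ.-_ eq)

module _ (D Q : ℕ) .{{_ : NonZero Q}} where

  cross-pell : ∀ x y → cross (pell D Q x y (1 , 0)) (pell D Q x y (0 , 1)) ≡
               + x ℤ.* + x ℤ.- + D ℤ.* + y ℤ.* (+ Q ℤ.* + y)
  cross-pell x y = begin
    + (x * 1 ℕ.+ D * y * 0) ℤ.* + (Q * y * 0 ℕ.+ x * 1) ℤ.- + (x * 0 ℕ.+ D * y * 1) ℤ.* + (Q * y * 1 ℕ.+ x * 0)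
      ≡⟨ cong₂ (λ i j → + i ℤ.* + (Q * y * 0 ℕ.+ x * 1) ℤ.- + j ℤ.* + (Q * y * 1 ℕ.+ x * 0)) (eq₁ x (D * y)) (eq₂ x (D * y)) ⟩
    + x ℤ.* + (Q * y * 0 ℕ.+ x * 1) ℤ.- + (D * y) ℤ.* + (Q * y * 1 ℕ.+ x * 0)
      ≡⟨ cong₂ (λ i j → + x ℤ.* + i ℤ.- + (D * y) ℤ.* + j) (eq₃ x (Q * y)) (eq₄ x (Q * y)) ⟩
    + x ℤ.* + x ℤ.- + (D * y) ℤ.* + (Q * y)
      ≡⟨ cong₂ (λ i j → + x ℤ.* + x ℤ.- i ℤ.* j) (ℤ.pos-* D y) (ℤ.pos-* Q y) ⟩
    + x ℤ.* + x ℤ.- + D ℤ.* + y ℤ.* (+ Q ℤ.* + y) ∎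
    where
    open ≡-Reasoning
    eq₁ : ∀ x z → x * 1 ℕ.+ z * 0 ≡ x
    eq₁ = ℕ-ring.solve-∀
    eq₂ : ∀ x z → x * 0 ℕ.+ z * 1 ≡ z
    eq₂ = ℕ-ring.solve-∀
    eq₃ : ∀ x z → z * 0 ℕ.+ x * 1 ≡ x
    eq₃ = ℕ-ring.solve-∀
    eq₄ : ∀ x z → z * 1 ℕ.+ x * 0 ≡ z
    eq₄ = ℕ-ring.solve-∀

  -- Multiplicativity of the norm; by `cross-pell` the factor is the determinant of the Pell matrix.
  form-pell : ∀ x y v → form D Q (pell D Q x y v) ≡
              (+ x ℤ.* + x ℤ.- + D ℤ.* + y ℤ.* (+ Q ℤ.* + y)) ℤ.* form D Q v
  form-pell x y (X , Y) = trans
    (cong₂ (λ i j → + Q ℤ.* (i ℤ.* i) ℤ.- + D ℤ.* (j ℤ.* j))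
      (trans (pos-bilinear x X (D * y) Y) (cong (λ i → + x ℤ.* + X ℤ.+ i ℤ.* + Y) (ℤ.pos-* D y)))
      (trans (pos-bilinear (Q * y) X x Y) (cong (λ i → i ℤ.* + X ℤ.+ + x ℤ.* + Y) (ℤ.pos-* Q y))))
    (eq (+ D) (+ Q) (+ x) (+ y) (+ X) (+ Y))
    where
    eq : ∀ D Q x y X Y →
      Q ℤ.* ((x ℤ.* X ℤ.+ D ℤ.* y ℤ.* Y) ℤ.* (x ℤ.* X ℤ.+ D ℤ.* y ℤ.* Y))
        ℤ.- D ℤ.* ((Q ℤ.* y ℤ.* X ℤ.+ x ℤ.* Y) ℤ.* (Q ℤ.* y ℤ.* X ℤ.+ x ℤ.* Y)) ≡
      (x ℤ.* x ℤ.- D ℤ.* y ℤ.* (Q ℤ.* y)) ℤ.* (Q ℤ.* (X ℤ.* X) ℤ.- D ℤ.* (Y ℤ.* Y))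
    eq = ℤ-ring.solve-∀

  module PellPeriod {k} (c : PeriodicCF k) (x y : ℕ) (W≡ : ∀ v → Period.W c v ≡ pell D Q x y v) where
    open Period c

    norm : + x ℤ.* + x ℤ.- + D ℤ.* + y ℤ.* (+ Q ℤ.* + y) ≡ sign (suc k)
    norm = trans (sym (cross-pell x y)) (trans (sym (cong₂ cross (W≡ (1 , 0)) (W≡ (0 , 1))))
      (trans (cross-W (1 , 0) (0 , 1)) (ℤ.*-identityʳ (sign (suc k)))))

    unimodular : Unimodular x (D * y) (Q * y) x
    unimodular = case (sign-cases (suc k))
      where
      solve-x² : ∀ s p q → p ℤ.- q ≡ s → p ≡ s ℤ.+ q
      solve-x² s p q eq = trans (add p q) (cong (ℤ._+ q) eq)
        where
        add : ∀ p q → p ≡ p ℤ.- q ℤ.+ q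
        add = ℤ-ring.solve-∀
      x²≡ : + (x * x) ≡ sign (suc k) ℤ.+ + (D * y * (Q * y))
      x²≡ = solve-x² (sign (suc k)) (+ (x * x)) (+ (D * y * (Q * y))) (trans (cong₂ ℤ._-_ (ℤ.pos-* x x)
        (trans (ℤ.pos-* (D * y) (Q * y)) (cong₂ ℤ._*_ (ℤ.pos-* D y) (ℤ.pos-* Q y)))) norm)
      case : sign (suc k) ≡ 1ℤ ⊎ sign (suc k) ≡ ℤ.- 1ℤ → Unimodular x (D * y) (Q * y) x
      case (inj₁ eq) = inj₁ (ℤ.+-injective (trans x²≡ (cong (ℤ._+ + (D * y * (Q * y))) eq)))
      case (inj₂ eq) = inj₂ (ℤ.+-injective (trans (cong (ℤ._+_ 1ℤ) (trans x²≡ (cong (ℤ._+ + (D * y * (Q * y))) eq)))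
        (cancel (+ (D * y * (Q * y))))))
        where
        cancel : ∀ i → 1ℤ ℤ.+ (ℤ.- 1ℤ ℤ.+ i) ≡ i
        cancel = ℤ-ring.solve-∀

    private
      h : ℕ → ℤ
      h n = sign n ℤ.* form D Q (col term n)

    -- Over a period the sign and the form are both multiplied by `sign (suc k)`, and these factors
    -- cancel.
    h-period : ∀ n → h (suc k ℕ.+ n) ≡ h n
    h-period n = begin
      sign (suc k ℕ.+ n) ℤ.* form D Q (col term (suc k ℕ.+ n))
        ≡⟨ cong₂ ℤ._*_ (sign-+ (suc k) n) (cong (form D Q) (trans (col-period n) (W≡ (col term n)))) ⟩
      s ℤ.* sign n ℤ.* form D Q (pell D Q x y (col term n))
        ≡⟨ cong (s ℤ.* sign n ℤ.*_) (trans (form-pell x y (col term n)) (cong (ℤ._* form D Q (col term n)) norm)) ⟩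
      s ℤ.* sign n ℤ.* (s ℤ.* form D Q (col term n))
        ≡⟨ regroup s (sign n) (form D Q (col term n)) ⟩
      (s ℤ.* s) ℤ.* h n   ≡⟨ cong (ℤ._* h n) (sign*sign (suc k)) ⟩
      1ℤ ℤ.* h n          ≡⟨ ℤ.*-identityˡ (h n) ⟩
      h n                 ∎
      where
      open ≡-Reasoning
      s = sign (suc k)
      regroup : ∀ s t g → s ℤ.* t ℤ.* (s ℤ.* g) ≡ (s ℤ.* s) ℤ.* (t ℤ.* g)
      regroup = ℤ-ring.solve-∀

    h-periods : ∀ l n → h (l * suc k ℕ.+ n) ≡ h n
    h-periods zero    n = refl
    h-periods (suc l) n = trans (cong h (ℕ.+-assoc (suc k) (l * suc k) n))
      (trans (h-period (l * suc k ℕ.+ n)) (h-periods l n))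

    -- Periodicity gives positivity at the columns `suc i * suc k` and the one after it. They belong
    -- to consecutive convergents of index at least i, from which `straddles-down` descends to i.
    pell⇒straddles : 0ℤ ℤ.< h 0 → 0ℤ ℤ.< h 1 → ∀ i → Straddles (+ D / Q) (cf term term≢0) i
    pell⇒straddles 0<h0 0<h1 i = Alternating.straddles-down (cf term term≢0) (0<cf term term≢0)
      (cf-alternates term term≢0) {+ D / Q} (k ℕ.+ i * k) i
      (form⇒straddles D Q term≢0 (k ℕ.+ i * k ℕ.+ i)
        (subst (λ n → 0ℤ ℤ.< h n) (sym index₀) (subst (0ℤ ℤ.<_) (sym (h-periods (suc i) 0)) 0<h0)))
      (form⇒straddles D Q term≢0 (suc (k ℕ.+ i * k) ℕ.+ i)
        (subst (λ n → 0ℤ ℤ.< h n) (sym index₁) (subst (0ℤ ℤ.<_) (sym (h-periods (suc i) 1)) 0<h1)))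
      where
      eq : ∀ k i → suc (k ℕ.+ i * k ℕ.+ i) ≡ suc i * suc k ℕ.+ 0
      eq = ℕ-ring.solve-∀
      index₀ : suc (k ℕ.+ i * k ℕ.+ i) ≡ suc i * suc k ℕ.+ 0
      index₀ = eq k i
      index₁ : suc (suc (k ℕ.+ i * k) ℕ.+ i) ≡ suc i * suc k ℕ.+ 1
      index₁ = trans (cong suc (eq k i)) (sym (ℕ.+-suc (suc i * suc k) 0))

  private
    pos-form : ∀ c z → + c ℤ.* (+ z ℤ.* + z) ≡ + (c * (z * z))
    pos-form c z = sym (trans (ℤ.pos-* c (z * z)) (cong (+ c ℤ.*_) (ℤ.pos-* z z)))

  module _ {a : Seq} (a⁺ : Pos a) (h : Alternates D Q a) where

    -- With `floor-upper` this makes `a 0` the integer part of √(D/Q), so that every Pell matrix can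
    -- be factored with the initial term of the given expansion.
    floor-lower : Q * (a 0 * a 0) ℕ.< D
    floor-lower = subst₂ ℕ._<_ (eq₁ Q (a 0)) (eq₂ D) (ℤ.drop‿+<+
      (subst₂ ℤ._<_ (pos-form Q (a 0 * 1 ℕ.+ 0)) (pos-form D 1)
        (sign⇒alt 0 {+ Q ℤ.* (+ (a 0 * 1 ℕ.+ 0) ℤ.* + (a 0 * 1 ℕ.+ 0))} {+ D ℤ.* (+ 1 ℤ.* + 1)} (h 1))))
      where
      eq₁ : ∀ Q a → Q * ((a * 1 ℕ.+ 0) * (a * 1 ℕ.+ 0)) ≡ Q * (a * a)
      eq₁ = ℕ-ring.solve-∀
      eq₂ : ∀ D → D * (1 * 1) ≡ D
      eq₂ = ℕ-ring.solve-∀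

    floor-upper : D ℕ.< Q * (suc (a 0) * suc (a 0))
    floor-upper = ℕ.*-cancelʳ-< (c * c) D (Q * (suc (a 0) * suc (a 0))) (begin-strict
      D * (c * c)                          <⟨ ℤ.drop‿+<+ (subst₂ ℤ._<_ (pos-form D c) (pos-form Q b)
                                                (sign⇒alt 1 {+ Q ℤ.* (+ b ℤ.* + b)} {+ D ℤ.* (+ c ℤ.* + c)} (h 2))) ⟩
      Q * (b * b)                          ≤⟨ ℕ.*-monoʳ-≤ Q (ℕ.*-mono-≤ b≤ b≤) ⟩
      Q * ((suc (a 0) * c) * (suc (a 0) * c)) ≡⟨ eq Q (a 0) c ⟩
      Q * (suc (a 0) * suc (a 0)) * (c * c)  ∎)
      where
      open ℕ.≤-Reasoning
      c = a 1 * 1 ℕ.+ 0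
      b = a 0 * c ℕ.+ 1
      b≤ : b ≤ suc (a 0) * c
      b≤ = ℕ.≤-trans (ℕ.+-monoʳ-≤ (a 0 * c) (0<num (a ∘ suc) (a⁺ ∘ suc) 1)) (ℕ.≤-reflexive (ℕ.+-comm (a 0 * c) c))
      eq : ∀ Q a c → Q * ((suc a * c) * (suc a * c)) ≡ Q * (suc a * suc a) * (c * c)
      eq = ℕ-ring.solve-∀

  converges⇒alternates : ∀ {m} (b : PeriodicCF m) → √ (+ D / Q) ≐ b → Alternates D Q (PeriodicCF.term b)
  converges⇒alternates b √≐b zero = subst (0ℤ ℤ.<_) (eq (+ Q) (+ D)) (ℤ.+<+ (ℕ.>-nonZero⁻¹ Q))
    where
    eq : ∀ Q D → Q ≡ 1ℤ ℤ.* (Q ℤ.* (1ℤ ℤ.* 1ℤ) ℤ.- D ℤ.* (0ℤ ℤ.* 0ℤ))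
    eq = ℤ-ring.solve-∀
  converges⇒alternates b √≐b (suc k) = straddles⇒form D Q term≢0 k
    (Alternating.converges⇒straddles (cf term term≢0) (0<cf term term≢0) (cf-alternates term term≢0) √≐b k)
    where open PeriodicCF b

  -- Minimality is demanded in both coordinates, so that antisymmetry identifies the solutions found
  -- from two different expansions.
  record Fundamental {m} (b : PeriodicCF m) : Set where
    field
      x y     : ℕ
      0<y     : 0 ℕ.< y
      W≡      : ∀ v → Period.W b v ≡ pell D Q x y v
      sol     : Unimodular x (D * y) (Q * y) x
      minimal : ∀ x′ y′ → 0 ℕ.< y′ → Unimodular x′ (D * y′) (Q * y′) x′ → x ≤ x′ × y ≤ y′

  module _ {m} (b : PeriodicCF m) (√≐b : √ (+ D / Q) ≐ b)
           (m-min : ∀ {k} (c : PeriodicCF k) → √ (+ D / Q) ≐ c → m ≤ k) where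

    private
      module B = Period b
      h = converges⇒alternates b √≐b

    module FromSolution (x y : ℕ) (0<y : 0 ℕ.< y) (sol : Unimodular x (D * y) (Q * y) x)
      {k} (cs : Vec ℕ k) (cs≢0 : ∀ i → NonZero (lookup cs i))
      (act≡ : ∀ v → step B.b₀ (actVec cs (proj₁ v ℕ.+ B.b₀ * proj₂ v , proj₂ v)) ≡ pell D Q x y v) where

      c : PeriodicCF k
      c = record { b₀ = B.b₀ ; bs = cs ; b₀≢0 = B.b₀≢0 ; bs≢0 = cs≢0 }

      module C = Period c

      W≡ : ∀ v → C.W v ≡ pell D Q x y v
      W≡ v = trans (cong (step B.b₀) (act-lookup (C.term ∘ suc) cs C.term-lookup (C.shear v))) (act≡ v)

      b≗c : ∀ i → B.term i ≡ C.term i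
      b≗c = straddles-unique {+ D / Q} B.term≢0 C.term≢0
        (Alternating.converges⇒straddles (cf B.term B.term≢0) (0<cf B.term B.term≢0) (cf-alternates B.term B.term≢0) √≐b)
        -- `h 0` and `h 1` are statements about `b`; they serve for `c` because columns 0 and 1
        -- involve only the shared initial term.
        (PellPeriod.pell⇒straddles c x y W≡ (h 0) (h 1))

      √≐c : √ (+ D / Q) ≐ c
      √≐c ε 0<ε = proj₁ (√≐b ε 0<ε) , λ j N≤j →
        subst (λ z → (z ℚ.- ε <√ (+ D / Q)) × (√ (+ D / Q) < z ℚ.+ ε))
          (cf-cong B.term≢0 C.term≢0 b≗c j) (proj₂ (√≐b ε 0<ε) j N≤j)

      col≡ : col B.term (suc k) ≡ pell D Q x y (1 , 0)
      col≡ = trans (act-cong b≗c (suc k) (1 , 0)) (trans (cong (col C.term) (sym (ℕ.+-identityʳ (suc k))))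
        (trans (C.col-period 0) (W≡ (1 , 0))))

      -- Now that `c` is known to be an expansion of √(D/Q), minimality gives m ≤ k. The first
      -- columns of the two Pell matrices are columns `suc m` and `suc k` of one sequence, so
      -- monotonicity compares them.
      compare : ∀ x₀ y₀ → (∀ v → B.W v ≡ pell D Q x₀ y₀ v) → x₀ ≤ x × y₀ ≤ y
      compare x₀ y₀ W₀≡ =
          subst₂ _≤_ (eq₁ x₀ (D * y₀)) (eq₁ x (D * y)) (proj₁ col≤)
        , ℕ.*-cancelˡ-≤ Q (subst₂ _≤_ (eq₁ (Q * y₀) x₀) (eq₁ (Q * y) x) (proj₂ col≤))
        where
        eq₁ : ∀ x z → x * 1 ℕ.+ z * 0 ≡ x
        eq₁ = ℕ-ring.solve-∀
        col₀≡ : col B.term (suc m) ≡ pell D Q x₀ y₀ (1 , 0)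
        col₀≡ = trans (cong (col B.term) (sym (ℕ.+-identityʳ (suc m)))) (trans (B.col-period 0) (W₀≡ (1 , 0)))
        col≤ : proj₁ (pell D Q x₀ y₀ (1 , 0)) ≤ proj₁ (pell D Q x y (1 , 0)) ×
               proj₂ (pell D Q x₀ y₀ (1 , 0)) ≤ proj₂ (pell D Q x y (1 , 0))
        col≤ = subst₂ (λ u v → proj₁ u ≤ proj₁ v × proj₂ u ≤ proj₂ v) col₀≡ col≡
          (col-mono B.term B.term≢0 (ℕ.s≤s (m-min c √≐c)))

    fundamental : gcd D Q ≡ 1 → Fundamental b
    fundamental gcd≡1 = go (alternates⇒pell D Q b h gcd≡1)
      where
      go : ∃[ x ] ∃[ y ] 0 ℕ.< y × (∀ v → B.W v ≡ pell D Q x y v) → Fundamental b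
      go (x₀ , y₀ , 0<y₀ , W₀≡) = record
        { x = x₀ ; y = y₀ ; 0<y = 0<y₀ ; W≡ = W₀≡
        ; sol = PellPeriod.unimodular b x₀ y₀ W₀≡
        ; minimal = λ x y 0<y sol → compare x y 0<y sol
            (pell-factor {D} {Q} {B.b₀} {x} {y} (floor-lower B.term≢0 h) (floor-upper B.term≢0 h) 0<y sol)
        }
        where
        compare : ∀ x y → 0 ℕ.< y → Unimodular x (D * y) (Q * y) x →
          ∃[ k ] ∃[ cs ] (∀ i → NonZero (lookup {n = k} cs i)) ×
            (∀ v → step B.b₀ (actVec cs (proj₁ v ℕ.+ B.b₀ * proj₂ v , proj₂ v)) ≡ pell D Q x y v) →
          x₀ ≤ x × y₀ ≤ y
        compare x y 0<y sol (k , cs , cs≢0 , act≡) =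
          FromSolution.compare x y 0<y sol cs cs≢0 act≡ x₀ y₀ W₀≡

-- Comparison of the two expansions

module _ (D Q : ℕ) .{{_ : NonZero Q}} where

  scale : ℕ × ℕ → ℕ × ℕ
  scale (x , y) = x , Q * y

  pell-scale : ∀ x y v → pell D Q x y (scale v) ≡ scale (pell (D * Q) 1 x y v)
  pell-scale x y (X , Y) = cong₂ _,_ (eq₁ D Q x y X Y) (eq₂ Q x y X Y)
    where
    eq₁ : ∀ D Q x y X Y → x * X ℕ.+ D * y * (Q * Y) ≡ x * X ℕ.+ D * Q * y * Y
    eq₁ = ℕ-ring.solve-∀
    eq₂ : ∀ Q x y X Y → Q * y * X ℕ.+ x * (Q * Y) ≡ Q * (1 * y * X ℕ.+ x * Y)
    eq₂ = ℕ-ring.solve-∀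

  unimodular-scale : ∀ x y → Unimodular x (D * y) (Q * y) x ≡ Unimodular x (D * Q * y) (1 * y) x
  unimodular-scale x y = cong (λ z → x * x ≡ 1 ℕ.+ z ⊎ 1 ℕ.+ x * x ≡ z) (eq D Q y)
    where
    eq : ∀ D Q y → D * y * (Q * y) ≡ D * Q * y * (1 * y)
    eq = ℕ-ring.solve-∀

  module _ {m n} (b : PeriodicCF m) (b′ : PeriodicCF n)
           (F : Fundamental D Q b) (F′ : Fundamental (D * Q) 1 b′) where

    private
      module F  = Fundamental F
      module F′ = Fundamental F′
      module B  = Period b
      module B′ = Period b′

      F≤F′ : F.x ≤ F′.x × F.y ≤ F′.y
      F≤F′ = F.minimal F′.x F′.y F′.0<y (subst (λ A → A) (sym (unimodular-scale F′.x F′.y)) F′.sol)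

      F′≤F : F′.x ≤ F.x × F′.y ≤ F.y
      F′≤F = F′.minimal F.x F.y F.0<y (subst (λ A → A) (unimodular-scale F.x F.y) F.sol)

      W-scale : ∀ v → B.W (scale v) ≡ scale (B′.W v)
      W-scale v = trans (F.W≡ (scale v)) (trans (pell-scale F.x F.y v)
        (cong scale (trans
          (cong₂ (λ x y → pell (D * Q) 1 x y v) (ℕ.≤-antisym (proj₁ F≤F′) (proj₁ F′≤F))
                                                (ℕ.≤-antisym (proj₂ F≤F′) (proj₂ F′≤F)))
          (sym (F′.W≡ v)))))

    -- Both orbits start at (1 , 0), which `scale` fixes, and `W-scale` carries the relation across
    -- one period of each.
    col-scale : ∀ l → col B.term (l * suc m) ≡ scale (col B′.term (l * suc n))
    col-scale zero    = cong (1 ,_) (sym (ℕ.*-zeroʳ Q))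
    col-scale (suc l) = trans (B.col-period (l * suc m)) (trans (cong B.W (col-scale l))
      (trans (W-scale (col B′.term (l * suc n))) (cong scale (sym (B′.col-period (l * suc n))))))

    convergents-scale : ∀ l →
      (↥ convergent b (suc l * suc m ∸ 1) ≡ ↥ convergent b′ (suc l * suc n ∸ 1)) ×
      (↧ₙ convergent b (suc l * suc m ∸ 1) ≡ ↧ₙ convergent b′ (suc l * suc n ∸ 1) * Q)
    convergents-scale l =
        trans (proj₁ c) (trans (cong (λ v → + proj₁ v) (col-scale (suc l))) (sym (proj₁ c′)))
      , trans (proj₂ c) (trans (cong proj₂ (col-scale (suc l)))
          (trans (ℕ.*-comm Q _) (cong (_* Q) (sym (proj₂ c′)))))
      where
      -- `suc l * suc m ∸ 1` reduces to this index, and the corresponding column is then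
      -- `suc l * suc m`.
      c  = cf-col B.term B.term≢0 (m ℕ.+ l * suc m)
      c′ = cf-col B′.term B′.term≢0 (n ℕ.+ l * suc n)

corollary1 : ∀ (D Q : ℕ) .{{_ : NonZero D}} .{{_ : NonZero Q}} →
    gcd D Q ≡ 1 →
    1ℚ ℚ.< + D / Q →
    ¬ (∃[ x ] x ℚ.* x ≡ + D / Q) →
    ∀ {m} (b : PeriodicCF m) → √ (+ D / Q) ≐ b →
    (∀ {k} (c : PeriodicCF k) → √ (+ D / Q) ≐ c → m ≤ k) →
    ∀ {n} (b′ : PeriodicCF n) → √ (+ (D * Q) / 1) ≐ b′ →
    (∀ {k} (c : PeriodicCF k) → √ (+ (D * Q) / 1) ≐ c → n ≤ k) →
    ∀ (l : ℕ) .{{_ : NonZero l}} →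
    (↥ convergent b (l * suc m ∸ 1) ≡ ↥ convergent b′ (l * suc n ∸ 1)) ×
    (↧ₙ convergent b (l * suc m ∸ 1) ≡ ↧ₙ convergent b′ (l * suc n ∸ 1) * Q)
corollary1 D Q gcd≡1 _ _ b √≐b m-min b′ √≐b′ n-min (suc l) =
  convergents-scale D Q b b′ (fundamental D Q b √≐b m-min gcd≡1)
    (fundamental (D * Q) 1 b′ √≐b′ n-min
      (Coprimality.coprime⇒gcd≡1 (Coprimality.sym (Coprimality.1-coprimeTo (D * Q))))) l
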